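{- Let $(p_n)_{n\in\omega}$ be the hitting probabilities of the random online functions. If $x\in 2^\omega$ is in the range of some random online function, then there is $c\in\omega$ such that for all $n$, \[ K(x\upharpoonright n)\geq -\log p_n-c . \] In particular, $x$ is complex.
   Context: $2^{<\omega}$ is the set of finite binary strings, $\epsilon$ the empty string, $y\upharpoonright n=(y(0),\dots,y(n-1))$, and $[\![\sigma]\!]=\{x\in 2^\omega:\sigma\prec x\}$. Let $\sigma_0=\epsilon,\sigma_1,\sigma_2,\dots$ list $2^{<\omega}$ in length-lexicographic order. Each $z\in 2^\omega$ codes the representing function $f_z:2^{<\omega}\setminus\{\epsilon\}\to\{0,1\}$, $f_z(\sigma_{n+1})=z(n)$, and the online function $F_z:2^\omega\to 2^\omega$, $F_z(y)(n)=f_z(y\upharpoonright (n+1))$. A random online function is an $F_z$ with $z$ Martin-Löf random with respect to the uniform measure on $2^\omega$. Hitting probabilities: $p_n$ is the probability (uniform measure of the set of codes $z\in 2^\omega$) that $\mathrm{ran}(F_z)\cap[\![\sigma]\!]\neq\emptyset$, for a fixed $\sigma$ of length $n$ (the value depends only on $n$). These satisfy $p_0=1$, $p_1=3/4$ and $p_{n+1}=p_n(1-\tfrac14 p_n)$. $K$ denotes prefix-free Kolmogorov complexity and $\log$ is base $2$. An order function is a non-decreasing unbounded function $g:\omega\to\omega$. A real $x\in 2^\omega$ is complex if there is a computable order function $g$ with $K(x\upharpoonright n)\ge g(n)$ for every $n$. -}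

module Defs where

open import Data.Bool.Base using (Bool; true; false; if_then_else_)
open import Data.Fin.Base using (Fin)
open import Data.Integer.Base using (+_)
open import Data.List.Base using (List; []; _∷_; length; foldl; applyUpTo; map; upTo)
open import Data.List.Membership.Propositional using (_∈_)
open import Data.List.Relation.Binary.Prefix.Heterogeneous using (Prefix)
open import Data.List.Relation.Unary.All using (All)
open import Data.List.Relation.Unary.Any using (Any)
open import Data.List.Relation.Unary.Unique.Propositional using (Unique)
open import Data.Nat.Base as ℕ using (ℕ; zero; suc; pred; _+_; _*_; _^_; _≤_; _<_)
open import Data.Nat.Properties using (m^n≢0)
open import Data.Product.Base using (Σ-syntax; ∃-syntax; _×_)
open import Data.Rational.Base as ℚ using (ℚ; 1ℚ)
open import Data.Unit.Base using (⊤)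
open import Data.Vec.Base as Vec using (Vec; []; _∷_)
open import Function.Bundles using (_⇔_)
open import Relation.Binary.PropositionalEquality using (_≡_; _≗_; refl)
open import Relation.Nullary.Negation.Core using (¬_)

-- Strings and Cantor space

String : Set
String = List Bool

Cantor : Set
Cantor = ℕ → Bool

infix 8 _↾_
_↾_ : Cantor → ℕ → String
x ↾ n = applyUpTo x n

⟦_⟧ : String → Cantor → Set
⟦ σ ⟧ x = x ↾ length σ ≡ σ

-- The position of a string in the length-lexicographic listing
-- ε, 0, 1, 00, 01, 10, 11, 000, …  (σ has position (1σ)₂ ∸ 1).
-- This is a bijection, and it also serves as the coding of strings by
-- numbers in everything concerning computability.
index : String → ℕ
index = foldl (λ n b → 1 + 2 * n + (if b then 1 else 0)) 0

private
  index-listing :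
    map index ( []
              ∷ (false ∷ [])
              ∷ (true ∷ [])
              ∷ (false ∷ false ∷ [])
              ∷ (false ∷ true ∷ [])
              ∷ (true ∷ false ∷ [])
              ∷ (true ∷ true ∷ [])
              ∷ (false ∷ false ∷ false ∷ [])
              ∷ []) ≡ upTo 8
  index-listing = refl

-- Only meaningful for nonempty strings, whose index is positive.
f : Cantor → String → Bool
f z σ = z (pred (index σ))

F : Cantor → Cantor → Cantor
F z y n = f z (y ↾ suc n)

-- Uniform measure

-- A is the clopen set of all z with z ↾ depth ∈ strings, and q is its
-- uniform measure.
record HasMeasure (A : Cantor → Set) (q : ℚ) : Set where
  field
    depth   : ℕ
    strings : List String
    unique  : Unique strings
    lengths : All (λ σ → length σ ≡ depth) strings
    clopen  : ∀ z → A z ⇔ (z ↾ depth ∈ strings)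
    measure : q ≡ ℚ._/_ (+ length strings) (2 ^ depth) {{m^n≢0 2 depth}}

-- The open set ⋃_{σ ∈ W} ⟦σ⟧ has uniform measure at most q.  As it is the
-- directed union of the clopen sets ⋃_{σ ∈ L} ⟦σ⟧, with L ⊆ W finite, its
-- measure is the supremum of theirs.
OpenMeasure≤ : (String → Set) → ℚ → Set
OpenMeasure≤ W q =
  ∀ (L : List String) → All W L →
  ∀ r → HasMeasure (λ z → Any (λ σ → ⟦ σ ⟧ z) L) r → r ℚ.≤ q

-- p n is the probability over z that ran(F z) meets ⟦ σ ⟧, for every σ of
-- length n.
HittingProbabilities : (ℕ → ℚ) → Set
HittingProbabilities p =
  ∀ σ → HasMeasure (λ z → ∃[ y ] ⟦ σ ⟧ (F z y)) (p (length σ))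

-- Partial recursive functions

data Rec : ℕ → Set where
  zeroᵣ : Rec 0
  sucᵣ  : Rec 1
  projᵣ : ∀ {n} → Fin n → Rec n
  compᵣ : ∀ {m n} → Rec m → Vec (Rec n) m → Rec n
  precᵣ : ∀ {n} → Rec n → Rec (2 + n) → Rec (suc n)
  muᵣ   : ∀ {n} → Rec (suc n) → Rec n

-- Eval e v y: the partial function given by e is defined at v, with value y.
mutual
  Eval : ∀ {n} → Rec n → Vec ℕ n → ℕ → Set
  Eval zeroᵣ        v        y = y ≡ 0
  Eval sucᵣ         (a ∷ []) y = y ≡ suc a
  Eval (projᵣ i)    v        y = y ≡ Vec.lookup v i
  Eval (compᵣ e es) v        y = ∃[ w ] (Evals es v w × Eval e w y)
  Eval (precᵣ e h)  (a ∷ v)  y = EvalPrec e h a v y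
  Eval (muᵣ e)      v        y =
    Eval e (y ∷ v) 0 × (∀ i → i < y → ∃[ k ] Eval e (i ∷ v) (suc k))

  Evals : ∀ {m n} → Vec (Rec n) m → Vec ℕ n → Vec ℕ m → Set
  Evals []       v []      = ⊤
  Evals (e ∷ es) v (y ∷ w) = Eval e v y × Evals es v w

  EvalPrec : ∀ {n} → Rec n → Rec (2 + n) → ℕ → Vec ℕ n → ℕ → Set
  EvalPrec e h zero    v y = Eval e v y
  EvalPrec e h (suc a) v y =
    ∃[ u ] (EvalPrec e h a v u × Eval h (a ∷ u ∷ v) y)

Computable : (ℕ → ℕ) → Set
Computable g = Σ[ e ∈ Rec 1 ] (∀ n → Eval e (n ∷ []) (g n))

-- Martin-Löf randomness

-- The n-th set of strings enumerated by e is the range of the partial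
-- recursive function k ↦ e(n,k).
Enumerates : Rec 2 → ℕ → String → Set
Enumerates e n σ = ∃[ k ] Eval e (n ∷ k ∷ []) (index σ)

record MLTest : Set where
  field
    enum  : Rec 2
    small : ∀ n → OpenMeasure≤ (Enumerates enum n)
                               (ℚ._/_ (+ 1) (2 ^ n) {{m^n≢0 2 n}})

_∈Component_of_ : Cantor → ℕ → MLTest → Set
z ∈Component n of T = ∃[ σ ] (Enumerates (MLTest.enum T) n σ × ⟦ σ ⟧ z)

MLRandom : Cantor → Set
MLRandom z = ∀ T → ¬ (∀ n → z ∈Component n of T)

InRangeOfRandomOnline : Cantor → Set
InRangeOfRandomOnline x = ∃[ z ] (MLRandom z × ∃[ y ] F z y ≗ x)

-- Prefix-free complexity

Outputs : Rec 1 → String → String → Set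
Outputs M π σ = Eval M (index π ∷ []) (index σ)

PrefixFree : Rec 1 → Set
PrefixFree M = ∀ {π ρ σ τ} → Outputs M π σ → Outputs M ρ τ →
               Prefix _≡_ π ρ → π ≡ ρ

record OptimalPrefixFree (U : Rec 1) : Set where
  field
    prefixFree : PrefixFree U
    optimal    : ∀ M → PrefixFree M →
                 ∃[ c ] (∀ π σ → Outputs M π σ →
                         ∃[ ρ ] (Outputs U ρ σ × length ρ ≤ length π + c))

-- K is the prefix-free complexity function of some optimal prefix-free
-- machine.
record IsPrefixComplexity (K : String → ℕ) : Set where
  field
    machine  : Rec 1
    isOpt    : OptimalPrefixFree machine
    attained : ∀ σ → ∃[ π ] (Outputs machine π σ × length π ≡ K σ)
    minimal  : ∀ σ π → Outputs machine π σ → K σ ≤ length π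

record IsOrder (g : ℕ → ℕ) : Set where
  field
    monotone  : ∀ {m n} → m ≤ n → g m ≤ g n
    unbounded : ∀ b → ∃[ n ] b ≤ g n

Complex : (String → ℕ) → Cantor → Set
Complex K x =
  ∃[ g ] (Computable g × IsOrder g × (∀ n → g n ≤ K (x ↾ n)))

-- k ≥ −log₂ q − c, exponentiated to 2^(k+c) · q ≥ 1 (for q > 0; if q ≤ 0,
-- where −log₂ q = ∞, it fails).
_≥-log₂_-_ : ℕ → ℚ → ℕ → Set
k ≥-log₂ q - c = 1ℚ ℚ.≤ ((+ (2 ^ (k + c))) ℚ./ 1) ℚ.* q

{-# OPTIONS --safe #-}

-- Whether ran (F z) meets ⟦ σ ⟧ is the survival of a branching process, and
-- comparing generations gives 1/(n+1) ≤ p n ≤ 4/(n+4).  For an optimal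
-- machine U, let level c of a test consist of the codes z such that ran (F z)
-- meets ⟦ σ ⟧ for some program π of some σ with 2^(|π|+c+2) ≤ |σ|.  Then
-- p |σ| ≤ 2^(−|π|−c), so by Kraft's inequality the level has measure at most
-- 2^(−c).  If x = F z y with z random, z escapes some level c, that is
-- n < 2^(K(x↾n)+c+2) for all n; by p n ≥ 1/(n+1) this is the bound on K, and it
-- makes the least k with n ≤ 2^(k+c+2) a computable order below K(x↾n).

module Submission where

open import Axiom.ExcludedMiddle using (ExcludedMiddle)
open import Data.Bool.Base using (Bool; true; false; not; _∧_; _∨_; if_then_else_)
import Data.Bool.Properties as Bool
open import Data.Fin.Base using (Fin)
open import Data.Fin.Patterns using (0F; 1F; 2F; 3F)
open import Data.Integer.Base as ℤ using (+≤+)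
open import Data.Integer.Properties using (pos-*)
open import Data.List.Base using (List; []; _∷_; _∷ʳ_; length; map; foldl; deduplicate)
open import Data.List.Membership.Propositional using (_∈_)
open import Data.List.Membership.Propositional.Properties using (∈-deduplicate⁺; ∈-deduplicate⁻)
open import Data.List.Properties using (∷-injective; length-applyUpTo; applyUpTo-∷ʳ; foldl-∷ʳ; ≡-dec)
open import Data.List.Relation.Binary.Prefix.Heterogeneous using (Prefix; []; _∷_)
open import Data.List.Relation.Unary.All as All using (All; []; _∷_)
open import Data.List.Relation.Unary.AllPairs using ([]; _∷_)
open import Data.List.Relation.Unary.Any using (Any; here; there)
open import Data.List.Relation.Unary.Unique.Propositional using (Unique)
import Data.List.Relation.Unary.Unique.DecPropositional.Properties as Unique
open import Data.Nat.Base using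
  (ℕ; zero; suc; pred; _+_; _*_; _^_; _∸_; _≤_; _<_; z≤n; s≤s; NonZero; >-nonZero)
open import Data.Nat.Induction using (<-rec)
open import Data.Nat.ListAction using (sum)
open import Data.Nat.Properties
open import Data.Nat.Tactic.RingSolver using (solve-∀)
open import Data.Product.Base using (∃-syntax; _×_; _,_; proj₁; proj₂)
import Data.Product.Properties as Product
open import Data.Rational.Base as ℚ using (ℚ; 1ℚ; toℚᵘ)
import Data.Rational.Properties as ℚ
open import Data.Rational.Unnormalised.Base as ℚᵘ using (mkℚᵘ; *≤*)
import Data.Rational.Unnormalised.Properties as ℚᵘ
open import Data.Sum.Base using (inj₁; inj₂)
open import Data.Unit.Base using (tt)
open import Data.Vec.Base using (Vec; []; _∷_; lookup)
open import Function.Base using (_∘_; const)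
open import Function.Bundles using (Equivalence)
open import Level using (0ℓ)
open import Relation.Binary.Definitions using (DecidableEquality; tri<; tri≈; tri>)
open import Relation.Binary.PropositionalEquality
open import Relation.Nullary.Decidable.Core using (yes; no)
open import Relation.Nullary.Negation.Core using (contradiction)
open import Defs

-- The logarithm of `p n` is never computed. Since `p n` lies between constant multiples of 1/(n+1),
-- `log n` can stand for `-log p n` up to a constant, and membership in a test level becomes a
-- comparison of natural numbers; the 2 in the exponent pays for the 4 in `p n ≤ 4/(n+4)`.
-- Probabilities are counts of codes at a finite depth `D`, chosen large enough for the finitely
-- many strings at hand; rationals enter only where measures are compared. Missing `σ`, unlike
-- hitting it, is a product over independent subtrees, so it is the misses that are integrated. The
-- levels must be enumerated by an explicit `Rec 2`. To avoid a search for a witness `y`, an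
-- enumerated prefix of `z` has as its length the index of a node `y ↾ n`: its bits include all
-- labels on the path to that node, so the length alone encodes the witness.

bit : Bool → ℕ
bit true  = 1
bit false = 0

bit≤1 : ∀ b → bit b ≤ 1
bit≤1 true  = ≤-refl
bit≤1 false = z≤n

agree : Bool → Bool → Bool
agree true  c = c
agree false c = not c

-- Cantor space and integration over finitely many bits

infixr 5 _◂_
_◂_ : Bool → Cantor → Cantor
(b ◂ z) zero    = b
(b ◂ z) (suc n) = z n

shift : ℕ → Cantor → Cantor
shift zero    z = z
shift (suc k) z = shift k (z ∘ suc)

-- 2^D times the integral of φ, if φ depends on the first D bits only.
∑ : ℕ → (Cantor → ℕ) → ℕ
∑ zero    φ = φ (const false)
∑ (suc D) φ = ∑ D (φ ∘ (false ◂_)) + ∑ D (φ ∘ (true ◂_))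

∑-mono : ∀ D {φ ψ} → (∀ z → φ z ≤ ψ z) → ∑ D φ ≤ ∑ D ψ
∑-mono zero    h = h _
∑-mono (suc D) h = +-mono-≤ (∑-mono D (h ∘ (false ◂_))) (∑-mono D (h ∘ (true ◂_)))

∑-cong : ∀ D {φ ψ} → (∀ z → φ z ≡ ψ z) → ∑ D φ ≡ ∑ D ψ
∑-cong zero    h = h _
∑-cong (suc D) h = cong₂ _+_ (∑-cong D (h ∘ (false ◂_))) (∑-cong D (h ∘ (true ◂_)))

∑-const : ∀ D k → ∑ D (λ _ → k) ≡ 2 ^ D * k
∑-const zero    k = sym (+-identityʳ k)
∑-const (suc D) k rewrite ∑-const D k = distrib (2 ^ D) k
  where
  distrib : ∀ a k → a * k + a * k ≡ 2 * a * k
  distrib = solve-∀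

∑-+ : ∀ D φ ψ → ∑ D (λ z → φ z + ψ z) ≡ ∑ D φ + ∑ D ψ
∑-+ zero    φ ψ = refl
∑-+ (suc D) φ ψ
  rewrite ∑-+ D (φ ∘ (false ◂_)) (ψ ∘ (false ◂_))
        | ∑-+ D (φ ∘ (true ◂_)) (ψ ∘ (true ◂_))
  = +-interchange (∑ D (φ ∘ (false ◂_))) (∑ D (ψ ∘ (false ◂_))) _ _
  where
  +-interchange : ∀ a b c d → a + b + (c + d) ≡ a + c + (b + d)
  +-interchange = solve-∀

∑-*ˡ : ∀ D k φ → ∑ D (λ z → k * φ z) ≡ k * ∑ D φ
∑-*ˡ zero    k φ = refl
∑-*ˡ (suc D) k φ
  rewrite ∑-*ˡ D k (φ ∘ (false ◂_)) | ∑-*ˡ D k (φ ∘ (true ◂_))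
  = sym (*-distribˡ-+ k _ _)

-- Fubini: the first `D` bits are independent of the rest. `Ψ` takes them as a string because `run`
-- consumes the code in such blocks.
∑-split : ∀ D E (Ψ : String → Cantor → ℕ) →
          ∑ (D + E) (λ z → Ψ (z ↾ D) (shift D z)) ≡ ∑ D (λ z → ∑ E (Ψ (z ↾ D)))
∑-split zero    E Ψ = refl
∑-split (suc D) E Ψ =
  cong₂ _+_ (∑-split D E (Ψ ∘ (false ∷_))) (∑-split D E (Ψ ∘ (true ∷_)))

∑-sum : ∀ {A : Set} D (φ : A → Cantor → ℕ) xs →
        ∑ D (λ z → sum (map (λ a → φ a z) xs)) ≡ sum (map (λ a → ∑ D (φ a)) xs)
∑-sum D φ []       = trans (∑-const D 0) (*-zeroʳ (2 ^ D))
∑-sum D φ (x ∷ xs) =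
  trans (∑-+ D (φ x) _) (cong (∑ D (φ x) +_) (∑-sum D φ xs))

-- Cylinders

_⊑ᵇ_ : String → Cantor → Bool
[]      ⊑ᵇ z = true
(b ∷ σ) ⊑ᵇ z = agree b (z 0) ∧ (σ ⊑ᵇ (z ∘ suc))

⊑ᵇ⇒⟦⟧ : ∀ σ z → (σ ⊑ᵇ z) ≡ true → ⟦ σ ⟧ z
⊑ᵇ⇒⟦⟧ []          z h = refl
⊑ᵇ⇒⟦⟧ (true  ∷ σ) z h with true  ← z 0 = cong (true  ∷_) (⊑ᵇ⇒⟦⟧ σ (z ∘ suc) h)
⊑ᵇ⇒⟦⟧ (false ∷ σ) z h with false ← z 0 = cong (false ∷_) (⊑ᵇ⇒⟦⟧ σ (z ∘ suc) h)

⟦⟧⇒⊑ᵇ : ∀ σ z → ⟦ σ ⟧ z → (σ ⊑ᵇ z) ≡ true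
⟦⟧⇒⊑ᵇ []      z h = refl
⟦⟧⇒⊑ᵇ (b ∷ σ) z h with ∷-injective h
⟦⟧⇒⊑ᵇ (true  ∷ σ) z h | z0 , hs rewrite z0 = ⟦⟧⇒⊑ᵇ σ (z ∘ suc) hs
⟦⟧⇒⊑ᵇ (false ∷ σ) z h | z0 , hs rewrite z0 = ⟦⟧⇒⊑ᵇ σ (z ∘ suc) hs

∑-cylinder : ∀ σ {D} → length σ ≤ D →
             2 ^ length σ * ∑ D (λ z → bit (σ ⊑ᵇ z)) ≡ 2 ^ D
∑-cylinder []          {D}     _       = trans (+-identityʳ _) (trans (∑-const D 1) (*-identityʳ _))
∑-cylinder (true  ∷ σ) {suc D} (s≤s h)
  rewrite ∑-const D 0 | *-zeroʳ (2 ^ D)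
  = trans (*-assoc 2 (2 ^ length σ) _) (cong (2 *_) (∑-cylinder σ h))
∑-cylinder (false ∷ σ) {suc D} (s≤s h)
  rewrite ∑-const D 0 | *-zeroʳ (2 ^ D) | +-identityʳ (∑ D (λ z → bit (σ ⊑ᵇ z)))
  = trans (*-assoc 2 (2 ^ length σ) _) (cong (2 *_) (∑-cylinder σ h))

-- Finite sums over lists

module _ {A : Set} where

  sum-mono : ∀ (f g : A → ℕ) xs → (∀ {x} → x ∈ xs → f x ≤ g x) →
             sum (map f xs) ≤ sum (map g xs)
  sum-mono f g []       h = z≤n
  sum-mono f g (x ∷ xs) h = +-mono-≤ (h (here refl)) (sum-mono f g xs (h ∘ there))

  sum-*ˡ : ∀ k (f : A → ℕ) xs → sum (map (λ x → k * f x) xs) ≡ k * sum (map f xs)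
  sum-*ˡ k f []       = sym (*-zeroʳ k)
  sum-*ˡ k f (x ∷ xs) rewrite sum-*ˡ k f xs = sym (*-distribˡ-+ k (f x) _)

  ∈⇒≤sum : ∀ (f : A → ℕ) {x xs} → x ∈ xs → f x ≤ sum (map f xs)
  ∈⇒≤sum f (here refl)          = m≤m+n _ _
  ∈⇒≤sum f {xs = y ∷ _} (there h) = ≤-trans (∈⇒≤sum f h) (m≤n+m _ (f y))

  sum-bit≡0 : ∀ (P : A → Bool) xs → (∀ {x} → x ∈ xs → P x ≡ false) →
              sum (map (bit ∘ P) xs) ≡ 0
  sum-bit≡0 P []       h = refl
  sum-bit≡0 P (x ∷ xs) h rewrite h (here refl) = sum-bit≡0 P xs (h ∘ there)

  sum-bit≤1 : ∀ (P : A → Bool) {xs} → Unique xs →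
              (∀ {x y} → x ∈ xs → y ∈ xs → P x ≡ true → P y ≡ true → x ≡ y) →
              sum (map (bit ∘ P) xs) ≤ 1
  sum-bit≤1 P []            h = z≤n
  sum-bit≤1 P {x ∷ xs} (x∉xs ∷ u) h with P x in Px
  ... | false = sum-bit≤1 P u (λ p q → h (there p) (there q))
  ... | true  = ≤-reflexive (cong suc (sum-bit≡0 P xs others))
    where
    others : ∀ {y} → y ∈ xs → P y ≡ false
    others {y} y∈ with P y in Py
    ... | false = refl
    ... | true  = contradiction (h (here refl) (there y∈) Px Py) (All.lookup x∉xs y∈)

double : ℕ → ℕ
double zero    = zero
double (suc n) = suc (suc (double n))

double≡+ : ∀ n → double n ≡ n + n
double≡+ zero    = refl
double≡+ (suc n) = cong suc (trans (cong suc (double≡+ n)) (sym (+-suc n n)))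

-- The hitting probabilities

-- Reading σ from the node with index i downwards: its children have indices
-- 2i+1 and 2i+2, labelled by the bits 2i and 2i+1 of the code.
hitᵇ : Cantor → ℕ → String → Bool
hitᵇ z i []      = true
hitᵇ z i (b ∷ σ) =
  (agree b (z (double i)) ∧ hitᵇ z (suc (double i)) σ) ∨
  (agree b (z (suc (double i))) ∧ hitᵇ z (suc (suc (double i))) σ)

hits : ℕ → String → ℕ
hits D σ = ∑ D (λ z → bit (hitᵇ z 0 σ))

-- One level of the branching process: as flags the nodes of a level that
-- are still alive, and every child of a live node whose label is b survives.
step : Bool → List Bool → String → List Bool
step b (a ∷ as) (c ∷ d ∷ bits) = (a ∧ agree b c) ∷ (a ∧ agree b d) ∷ step b as bits
step b (a ∷ as) (c ∷ [])       = []
step b (a ∷ as) []             = []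
step b []       bits           = []

length-step : ∀ b as z → length (step b as (z ↾ double (length as))) ≡ double (length as)
length-step b []       z = refl
length-step b (a ∷ as) z = cong (suc ∘ suc) (length-step b as (z ∘ suc ∘ suc))

-- Dead nodes keep their place in the list, so every level has full width and its labels form one
-- block of the code, whose length does not depend on which nodes survive.
run : String → List Bool → Cantor → List Bool
run []      as z = as
run (b ∷ σ) as z =
  run σ (step b as (z ↾ double (length as))) (shift (double (length as)) z)

∏ : (Bool → ℕ) → List Bool → ℕ
∏ w []       = 1
∏ w (a ∷ as) = w a * ∏ w as

-- The generating function of the process, cleared of denominators: four times the mean of
-- `w c * w d` over the flags `c`, `d` of the two children. A child of a live node is alive for one
-- of its two labels, a child of a dead node for none.
offspring : (Bool → ℕ) → Bool → ℕ
offspring w true  = (w false + w true) * (w false + w true)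
offspring w false = 4 * (w false * w false)

generation : (Bool → ℕ) → ℕ → Bool → ℕ
generation w zero    = w
generation w (suc n) = offspring (generation w n)

-- Nodes of one level read disjoint pairs of bits, so the integral of a product weight factors over
-- the nodes, whatever the wanted label `b`.
∑-step : ∀ b as w →
         ∑ (double (length as)) (λ z → ∏ w (step b as (z ↾ double (length as)))) ≡
         ∏ (offspring w) as
∑-step b []       w = refl
∑-step b (a ∷ as) w =
  trans (cong₂ _+_ (cong₂ _+_ (pull (a ∧ agree b false) (a ∧ agree b false))
                              (pull (a ∧ agree b false) (a ∧ agree b true)))
                   (cong₂ _+_ (pull (a ∧ agree b true) (a ∧ agree b false))
                              (pull (a ∧ agree b true) (a ∧ agree b true))))
        (collect a b)
  where
  D : ℕ
  D = double (length as)
  rest : Cantor → ℕ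
  rest z = ∏ w (step b as (z ↾ D))
  pull : ∀ c d → ∑ D (λ z → w c * (w d * rest z)) ≡ w c * (w d * ∏ (offspring w) as)
  pull c d = trans (∑-*ˡ D (w c) (λ z → w d * rest z))
    (cong (w c *_) (trans (∑-*ˡ D (w d) rest) (cong (w d *_) (∑-step b as w))))
  live : ∀ x y p → x * (x * p) + x * (y * p) + (y * (x * p) + y * (y * p)) ≡
                   (x + y) * (x + y) * p
  live = solve-∀
  live′ : ∀ x y p → y * (y * p) + y * (x * p) + (x * (y * p) + x * (x * p)) ≡
                    (x + y) * (x + y) * p
  live′ = solve-∀
  dead : ∀ x p → x * (x * p) + x * (x * p) + (x * (x * p) + x * (x * p)) ≡
                 4 * (x * x) * p
  dead = solve-∀
  collect : ∀ a b → let p = ∏ (offspring w) as in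
    w (a ∧ agree b false) * (w (a ∧ agree b false) * p) +
    w (a ∧ agree b false) * (w (a ∧ agree b true) * p) +
    (w (a ∧ agree b true) * (w (a ∧ agree b false) * p) +
     w (a ∧ agree b true) * (w (a ∧ agree b true) * p)) ≡ offspring w a * p
  collect true  true  = live (w false) (w true) (∏ (offspring w) as)
  collect true  false = live′ (w false) (w true) (∏ (offspring w) as)
  collect false b     = dead (w false) (∏ (offspring w) as)

-- The number of bits labelling the next n levels below a level of l nodes.
size : ℕ → ℕ → ℕ
size zero    l = 0
size (suc n) l = double l + size n (double l)

-- The `E` spare bits contribute only a factor; they allow strings of different lengths to be
-- integrated at one common depth.
∑-run : ∀ σ as E w →
        ∑ (size (length σ) (length as) + E) (λ z → ∏ w (run σ as z)) ≡
        2 ^ E * ∏ (generation w (length σ)) as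
∑-run []      as E w = ∑-const E _
∑-run (b ∷ σ) as E w = begin
  ∑ (D + D′ + E) (λ z → ∏ w (run (b ∷ σ) as z))
    ≡⟨ cong (λ k → ∑ k (λ z → ∏ w (run (b ∷ σ) as z))) (+-assoc D D′ E) ⟩
  ∑ (D + (D′ + E)) (λ z → ∏ w (run σ (step b as (z ↾ D)) (shift D z)))
    ≡⟨ ∑-split D (D′ + E) (λ τ z → ∏ w (run σ (step b as τ) z)) ⟩
  ∑ D (λ z → ∑ (D′ + E) (λ z′ → ∏ w (run σ (step b as (z ↾ D)) z′)))
    -- The flags after one step depend on `z`, but their number does not, so the induction
    -- hypothesis applies at the same depth for each `z`.
    ≡⟨ ∑-cong D (λ z → subst (λ l → ∑ (size n l + E) (λ z′ → ∏ w (run σ (step b as (z ↾ D)) z′)) ≡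
                                  2 ^ E * ∏ (generation w n) (step b as (z ↾ D)))
                             (length-step b as z) (∑-run σ (step b as (z ↾ D)) E w)) ⟩
  ∑ D (λ z → 2 ^ E * ∏ (generation w n) (step b as (z ↾ D)))
    ≡⟨ ∑-*ˡ D (2 ^ E) (λ z → ∏ (generation w n) (step b as (z ↾ D))) ⟩
  2 ^ E * ∑ D (λ z → ∏ (generation w n) (step b as (z ↾ D)))
    ≡⟨ cong (2 ^ E *_) (∑-step b as (generation w n)) ⟩
  2 ^ E * ∏ (generation w (suc n)) as ∎
  where
  open ≡-Reasoning
  n D D′ : ℕ
  n  = length σ
  D  = double (length as)
  D′ = size n D

miss : Bool → ℕ
miss b = bit (not b)

-- Consecutive nodes from index i on, flagged by as.
noHit : Cantor → String → ℕ → List Bool → ℕ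
noHit z σ i []       = 1
noHit z σ i (a ∷ as) = miss (a ∧ hitᵇ z i σ) * noHit z σ (suc i) as

-- Children of consecutive nodes are consecutive, and so are their labels; `x` is the code from bit
-- `2i` on. A node misses `b ∷ σ` iff each of its children is wrongly labelled or misses `σ`, which
-- turns `miss` of a disjunction into a product.
noHit-step : ∀ z b σ as i (x : Cantor) → (∀ k → x k ≡ z (double i + k)) →
             noHit z σ (suc (double i)) (step b as (x ↾ double (length as))) ≡
             noHit z (b ∷ σ) i as
noHit-step z b σ []       i x x≗ = refl
noHit-step z b σ (a ∷ as) i x x≗
  rewrite x≗ 0 | x≗ 1 | +-identityʳ (double i) | +-comm (double i) 1
        | noHit-step z b σ as (suc i) (x ∘ suc ∘ suc)
            (λ k → trans (x≗ (suc (suc k)))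
                     (cong z (trans (+-suc (double i) (suc k)) (cong suc (+-suc (double i) k)))))
  = merge a (agree b (z (double i))) _ (agree b (z (suc (double i)))) _ _
  where
  merge : ∀ a g h g′ h′ r →
          miss ((a ∧ g) ∧ h) * (miss ((a ∧ g′) ∧ h′) * r) ≡
          miss (a ∧ ((g ∧ h) ∨ (g′ ∧ h′))) * r
  merge false g     h     g′ h′ r = +-identityʳ (1 * r)
  merge true  true  true  g′ h′ r = refl
  merge true  true  false g′ h′ r = +-identityʳ _
  merge true  false h     g′ h′ r = +-identityʳ _

-- The i + 1 nodes of a level whose first node has index i are labelled
-- before the bit 2i.
noHit-run : ∀ z σ as i (x : Cantor) → (∀ k → x k ≡ z (double i + k)) →
            length as ≡ suc i → ∏ miss (run σ as x) ≡ noHit z σ i as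
noHit-run z [] as i x x≗ len = base as i
  where
  base : ∀ as i → ∏ miss as ≡ noHit z [] i as
  base []       i = refl
  base (a ∷ as) i = cong₂ _*_ (cong miss (sym (Bool.∧-identityʳ a))) (base as (suc i))
noHit-run z (b ∷ σ) as i x x≗ len =
  trans (noHit-run z σ (step b as (x ↾ D)) (suc (double i)) (shift D x) shifted
          (trans (length-step b as x) (cong double len)))
        (noHit-step z b σ as i x x≗)
  where
  D : ℕ
  D = double (length as)
  shift-at : ∀ m y k → shift m y k ≡ y (m + k)
  shift-at zero    y k = refl
  shift-at (suc m) y k = shift-at m (y ∘ suc) k
  arith : ∀ i k → i + i + (2 + (i + i) + k) ≡ 2 + (i + i + (i + i)) + k
  arith = solve-∀
  index-eq : ∀ i k → double i + (double (suc i) + k) ≡ double (suc (double i)) + k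
  index-eq i k rewrite double≡+ (double i) | double≡+ i = arith i k
  shifted : ∀ k → shift D x k ≡ z (double (suc (double i)) + k)
  shifted k = trans (shift-at D x k) (trans (x≗ (D + k))
    (cong z (trans (cong (λ l → double i + (double l + k)) len) (index-eq i k))))

∑-miss : ∀ σ E → ∑ (size (length σ) 1 + E) (λ z → miss (hitᵇ z 0 σ)) ≡
                 2 ^ E * generation miss (length σ) true
∑-miss σ E = begin
  ∑ D (λ z → miss (hitᵇ z 0 σ))
    ≡⟨ ∑-cong D (λ z → trans (sym (*-identityʳ _)) (sym (noHit-run z σ (true ∷ []) 0 z (λ _ → refl) refl))) ⟩
  ∑ D (λ z → ∏ miss (run σ (true ∷ []) z))
    ≡⟨ ∑-run σ (true ∷ []) E miss ⟩
  2 ^ E * (generation miss (length σ) true * 1)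
    ≡⟨ cong (2 ^ E *_) (*-identityʳ _) ⟩
  2 ^ E * generation miss (length σ) true ∎
  where
  open ≡-Reasoning
  D : ℕ
  D = size (length σ) 1 + E

-- Started from a dead root, the process never hits, so the same integral counts all codes. This
-- puts the total into the same recursion as the misses.
2^size : ∀ σ E → 2 ^ (size (length σ) 1 + E) ≡ 2 ^ E * generation miss (length σ) false
2^size σ E = begin
  2 ^ D
    ≡⟨ trans (sym (*-identityʳ _)) (sym (∑-const D 1)) ⟩
  ∑ D (λ z → 1)
    ≡⟨ ∑-cong D (λ z → sym (noHit-run z σ (false ∷ []) 0 z (λ _ → refl) refl)) ⟩
  ∑ D (λ z → ∏ miss (run σ (false ∷ []) z))
    ≡⟨ ∑-run σ (false ∷ []) E miss ⟩
  2 ^ E * (generation miss (length σ) false * 1)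
    ≡⟨ cong (2 ^ E *_) (*-identityʳ _) ⟩
  2 ^ E * generation miss (length σ) false ∎
  where
  open ≡-Reasoning
  D : ℕ
  D = size (length σ) 1 + E

-- With u, t, h counting all codes, those missing σ and those hitting σ,
-- p = h/u satisfies p′ = p(1 − p/4), that is h′ = h(4u − h) and u′ = 4u²,
-- so 1/4 ≤ 1/p′ − 1/p ≤ 1.
generation-bounds : ∀ n → ∃[ h ] (h + generation miss n true ≡ generation miss n false ×
                                  generation miss n false ≤ suc n * h ×
                                  (4 + n) * h ≤ 4 * generation miss n false)
generation-bounds zero    = 1 , refl , ≤-refl , ≤-refl
generation-bounds (suc n)
  with generation miss n true | generation miss n false | generation-bounds n
... | t | _ | h , refl , lower , upper = h * (3 * h + 4 * t) , total h t , lower′ , upper′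
  where
  open ≤-Reasoning
  total : ∀ h t → h * (3 * h + 4 * t) + (h + t + t) * (h + t + t) ≡ 4 * ((h + t) * (h + t))
  total = solve-∀
  lower₁ : ∀ h t → 4 * ((h + t) * (h + t)) + h * (2 * h + 3 * t) ≡
                   (h + (h + t)) * (3 * h + 4 * t)
  lower₁ = solve-∀
  upper₁ : ∀ h t → (h + 4 * (h + t)) * (3 * h + 4 * t) + h * h ≡
                   4 * (4 * ((h + t) * (h + t)))
  upper₁ = solve-∀
  lower′ : 4 * ((h + t) * (h + t)) ≤ (2 + n) * (h * (3 * h + 4 * t))
  lower′ = begin
    4 * ((h + t) * (h + t))                         ≤⟨ m≤m+n _ _ ⟩
    4 * ((h + t) * (h + t)) + h * (2 * h + 3 * t)   ≡⟨ lower₁ h t ⟩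
    (h + (h + t)) * (3 * h + 4 * t)
      ≤⟨ *-monoˡ-≤ (3 * h + 4 * t) (+-monoʳ-≤ h lower) ⟩
    (2 + n) * h * (3 * h + 4 * t)                   ≡⟨ *-assoc (2 + n) h _ ⟩
    (2 + n) * (h * (3 * h + 4 * t))                 ∎
  upper′ : (5 + n) * (h * (3 * h + 4 * t)) ≤ 4 * (4 * ((h + t) * (h + t)))
  upper′ = begin
    (5 + n) * (h * (3 * h + 4 * t))                 ≡⟨ sym (*-assoc (5 + n) h _) ⟩
    (5 + n) * h * (3 * h + 4 * t)
      ≤⟨ *-monoˡ-≤ (3 * h + 4 * t) (+-monoʳ-≤ h upper) ⟩
    (h + 4 * (h + t)) * (3 * h + 4 * t)             ≤⟨ m≤m+n _ _ ⟩
    (h + 4 * (h + t)) * (3 * h + 4 * t) + h * h     ≡⟨ upper₁ h t ⟩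
    4 * (4 * ((h + t) * (h + t)))                   ∎

-- Hits are recovered as the complement of the misses; `E` carries the bounds to every sufficient
-- depth.
hits-bounds : ∀ σ {D} → size (length σ) 1 ≤ D →
              2 ^ D ≤ suc (length σ) * hits D σ × (4 + length σ) * hits D σ ≤ 4 * 2 ^ D
hits-bounds σ {D} size≤D with m≤n⇒∃[o]m+o≡n size≤D
... | E , refl with generation-bounds (length σ)
...   | h , h+t≡u , lower , upper = lower′ , upper′
  where
  open ≤-Reasoning
  n s u t : ℕ
  n = length σ
  s = size n 1 + E
  u = generation miss n false
  t = generation miss n true
  indicator : ∀ b → bit b + miss b ≡ 1
  indicator true  = refl
  indicator false = refl
  swap : ∀ a b c → a * (b * c) ≡ b * (a * c)
  swap = solve-∀
  hits≡ : hits s σ ≡ 2 ^ E * h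
  hits≡ = +-cancelʳ-≡ (2 ^ E * t) _ _ (begin-equality
    hits s σ + 2 ^ E * t                       ≡⟨ cong (hits s σ +_) (sym (∑-miss σ E)) ⟩
    hits s σ + ∑ s (λ z → miss (hitᵇ z 0 σ))   ≡⟨ sym (∑-+ s _ _) ⟩
    ∑ s (λ z → bit (hitᵇ z 0 σ) + miss (hitᵇ z 0 σ)) ≡⟨ ∑-cong s (λ z → indicator (hitᵇ z 0 σ)) ⟩
    ∑ s (λ _ → 1)                              ≡⟨ trans (∑-const s 1) (*-identityʳ _) ⟩
    2 ^ s                                      ≡⟨ 2^size σ E ⟩
    2 ^ E * u                                  ≡⟨ cong (2 ^ E *_) (sym h+t≡u) ⟩
    2 ^ E * (h + t)                            ≡⟨ *-distribˡ-+ (2 ^ E) h t ⟩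
    2 ^ E * h + 2 ^ E * t                      ∎)
  lower′ : 2 ^ s ≤ suc n * hits s σ
  lower′ = begin
    2 ^ s                 ≡⟨ 2^size σ E ⟩
    2 ^ E * u             ≤⟨ *-monoʳ-≤ (2 ^ E) lower ⟩
    2 ^ E * (suc n * h)   ≡⟨ swap (2 ^ E) (suc n) h ⟩
    suc n * (2 ^ E * h)   ≡⟨ cong (suc n *_) (sym hits≡) ⟩
    suc n * hits s σ      ∎
  upper′ : (4 + n) * hits s σ ≤ 4 * 2 ^ s
  upper′ = begin
    (4 + n) * hits s σ       ≡⟨ cong ((4 + n) *_) hits≡ ⟩
    (4 + n) * (2 ^ E * h)    ≡⟨ swap (4 + n) (2 ^ E) h ⟩
    2 ^ E * ((4 + n) * h)    ≤⟨ *-monoʳ-≤ (2 ^ E) upper ⟩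
    2 ^ E * (4 * u)          ≡⟨ swap (2 ^ E) 4 u ⟩
    4 * (2 ^ E * u)          ≡⟨ cong (4 *_) (sym (2^size σ E)) ⟩
    4 * 2 ^ s                ∎

-- Hitting and the range of the online function

child : ℕ → Bool → ℕ
child i b = 1 + 2 * i + (if b then 1 else 0)

child-double : ∀ i b → child i b ≡ suc (double i + bit b)
child-double i true  rewrite double≡+ i | +-identityʳ i = refl
child-double i false rewrite double≡+ i | +-identityʳ i = refl

-- `path z 0` unfolds to `F z`; an arbitrary starting node lets the induction on `σ` pass to a
-- child.
path : Cantor → ℕ → Cantor → Cantor
path z i y n = z (pred (foldl child i (y ↾ suc n)))

agree-refl : ∀ b → agree b b ≡ true
agree-refl true  = refl
agree-refl false = refl

agree⇒≡ : ∀ b c → agree b c ≡ true → c ≡ b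
agree⇒≡ true  c     h = h
agree⇒≡ false false h = refl

hitᵇ-child : ∀ z i b σ c → z (pred (child i c)) ≡ b → hitᵇ z (child i c) σ ≡ true →
             hitᵇ z i (b ∷ σ) ≡ true
hitᵇ-child z i b σ c zc hit = at c _ (child-double i c) zc hit
  where
  at : ∀ c k → k ≡ suc (double i + bit c) → z (pred k) ≡ b → hitᵇ z k σ ≡ true →
       hitᵇ z i (b ∷ σ) ≡ true
  at false _ refl refl hit
    rewrite +-identityʳ (double i) | agree-refl (z (double i)) | hit = refl
  at true  _ refl refl hit
    rewrite +-comm (double i) 1 | agree-refl (z (suc (double i))) | hit = Bool.∨-zeroʳ _

hitᵇ-child⁻¹ : ∀ z i b σ → hitᵇ z i (b ∷ σ) ≡ true →
               ∃[ c ] (z (pred (child i c)) ≡ b × hitᵇ z (child i c) σ ≡ true)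
hitᵇ-child⁻¹ z i b σ h
  with agree b (z (double i)) in g | hitᵇ z (suc (double i)) σ in p
     | agree b (z (suc (double i))) in g′ | hitᵇ z (suc (suc (double i))) σ in p′
... | true | true | _ | _ =
  false , subst (λ k → z (pred k) ≡ b × hitᵇ z k σ ≡ true)
            (sym (trans (child-double i false) (cong suc (+-identityʳ _))))
            (agree⇒≡ b _ g , p)
... | _ | _ | true | true =
  true , subst (λ k → z (pred k) ≡ b × hitᵇ z k σ ≡ true)
           (sym (trans (child-double i true) (cong suc (+-comm _ 1))))
           (agree⇒≡ b _ g′ , p′)
hitᵇ-child⁻¹ z i b σ () | true | false | true | false
hitᵇ-child⁻¹ z i b σ () | true | false | false | _
hitᵇ-child⁻¹ z i b σ () | false | _ | true | false
hitᵇ-child⁻¹ z i b σ () | false | _ | false | _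

hitᵇ⇒path : ∀ z i σ → hitᵇ z i σ ≡ true → ∃[ y ] ⟦ σ ⟧ (path z i y)
hitᵇ⇒path z i []      h = const false , refl
hitᵇ⇒path z i (b ∷ σ) h with hitᵇ-child⁻¹ z i b σ h
... | c , zc , h′ with hitᵇ⇒path z (child i c) σ h′
...   | y , y∈ = c ◂ y , cong₂ _∷_ zc y∈

path⇒hitᵇ : ∀ z i σ y → ⟦ σ ⟧ (path z i y) → hitᵇ z i σ ≡ true
path⇒hitᵇ z i []      y h = refl
path⇒hitᵇ z i (b ∷ σ) y h with ∷-injective h
... | z0 , h′ = hitᵇ-child z i b σ (y 0) z0 (path⇒hitᵇ z (child i (y 0)) σ (y ∘ suc) h′)

hitᵇ⇒F : ∀ z σ → hitᵇ z 0 σ ≡ true → ∃[ y ] ⟦ σ ⟧ (F z y)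
hitᵇ⇒F z = hitᵇ⇒path z 0

F⇒hitᵇ : ∀ z σ y → ⟦ σ ⟧ (F z y) → hitᵇ z 0 σ ≡ true
F⇒hitᵇ z = path⇒hitᵇ z 0

-- Measures as normalised counts

∑-cylinders : ∀ {d D} (L : List String) → All (λ σ → length σ ≡ d) L → d ≤ D →
              2 ^ d * ∑ D (λ z → sum (map (λ σ → bit (σ ⊑ᵇ z)) L)) ≡ length L * 2 ^ D
∑-cylinders {d} {D} L lens d≤D =
  trans (cong (2 ^ d *_) (∑-sum D (λ σ z → bit (σ ⊑ᵇ z)) L)) (go L lens)
  where
  go : ∀ L → All (λ σ → length σ ≡ d) L →
       2 ^ d * sum (map (λ σ → ∑ D (λ z → bit (σ ⊑ᵇ z))) L) ≡ length L * 2 ^ D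
  go []      []            = *-zeroʳ (2 ^ d)
  go (σ ∷ L) (refl ∷ lens) =
    trans (*-distribˡ-+ (2 ^ d) _ _) (cong₂ _+_ (∑-cylinder σ d≤D) (go L lens))

module _ {A : Cantor → Set} {q : ℚ} (m : HasMeasure A q) where
  open HasMeasure m

  private
    ⊑ᵇ-unique : ∀ z {σ τ} → σ ∈ strings → τ ∈ strings →
                (σ ⊑ᵇ z) ≡ true → (τ ⊑ᵇ z) ≡ true → σ ≡ τ
    ⊑ᵇ-unique z {σ} {τ} σ∈ τ∈ σ⊑z τ⊑z =
      trans (sym (⊑ᵇ⇒⟦⟧ σ z σ⊑z))
        (trans (cong (z ↾_) (trans (All.lookup lengths σ∈) (sym (All.lookup lengths τ∈))))
               (⊑ᵇ⇒⟦⟧ τ z τ⊑z))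

    count : Cantor → ℕ
    count z = sum (map (λ σ → bit (σ ⊑ᵇ z)) strings)

    1≤count : ∀ z → A z → 1 ≤ count z
    1≤count z az =
      ≤-trans (≤-reflexive (sym (cong bit (⟦⟧⇒⊑ᵇ _ z (cong (z ↾_) (length-applyUpTo z depth))))))
              (∈⇒≤sum (λ σ → bit (σ ⊑ᵇ z)) (Equivalence.to (clopen z) az))

    count>0⇒∈ : ∀ z L → 1 ≤ sum (map (λ σ → bit (σ ⊑ᵇ z)) L) →
                ∃[ σ ] (σ ∈ L × (σ ⊑ᵇ z) ≡ true)
    count>0⇒∈ z (σ ∷ L) h with σ ⊑ᵇ z in σ⊑z
    ... | true  = σ , here refl , σ⊑z
    ... | false with count>0⇒∈ z L h
    ...   | τ , τ∈ , τ⊑z = τ , there τ∈ , τ⊑z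

    count⇒A : ∀ z → 1 ≤ count z → A z
    count⇒A z h with count>0⇒∈ z strings h
    ... | σ , σ∈ , σ⊑z =
      Equivalence.from (clopen z)
        (subst (_∈ strings) (trans (sym (⊑ᵇ⇒⟦⟧ σ z σ⊑z)) (cong (z ↾_) (All.lookup lengths σ∈))) σ∈)

  ∑≤measure : ∀ {D} (φ : Cantor → Bool) → depth ≤ D → (∀ z → φ z ≡ true → A z) →
              2 ^ depth * ∑ D (bit ∘ φ) ≤ length strings * 2 ^ D
  ∑≤measure {D} φ d≤D φ⇒A =
    ≤-trans (*-monoʳ-≤ (2 ^ depth) (∑-mono D bound))
            (≤-reflexive (∑-cylinders strings lengths d≤D))
    where
    bound : ∀ z → bit (φ z) ≤ count z
    bound z with φ z in φz
    ... | true  = 1≤count z (φ⇒A z φz)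
    ... | false = z≤n

  -- The `strings` are distinct and of equal length, so at most one of them is a prefix of `z`, and
  -- `count` is the indicator of `A`. As `ψ` may exceed 1, the events it counts may overlap, as in a
  -- union bound.
  measure≤∑ : ∀ {D} (ψ : Cantor → ℕ) → depth ≤ D → (∀ z → A z → 1 ≤ ψ z) →
              length strings * 2 ^ D ≤ 2 ^ depth * ∑ D ψ
  measure≤∑ {D} ψ d≤D A⇒ψ =
    ≤-trans (≤-reflexive (sym (∑-cylinders strings lengths d≤D)))
            (*-monoʳ-≤ (2 ^ depth) (∑-mono D bound))
    where
    bound : ∀ z → count z ≤ ψ z
    bound z with count z in eq | sum-bit≤1 (_⊑ᵇ z) unique (⊑ᵇ-unique z)
    ... | zero  | _ = z≤n
    ... | suc n | s≤s n≤0 = ≤-trans (s≤s n≤0) (A⇒ψ z (count⇒A z (subst (1 ≤_) (sym eq) (s≤s z≤n))))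

-- Kraft's inequality for hitting events

↾-prefix : ∀ (z : Cantor) {m n} → m ≤ n → Prefix _≡_ (z ↾ m) (z ↾ n)
↾-prefix z z≤n     = []
↾-prefix z (s≤s h) = refl ∷ ↾-prefix (z ∘ suc) h

-- Each pair contributes a hitting probability of at most 2^(−|π|−c), and
-- Kraft's inequality bounds the sum of the 2^(−|π|) by 1.
∑-hits≤ : ∀ c (Q : List (String × String)) → Unique Q →
          (∀ z {π σ ρ τ} → (π , σ) ∈ Q → (ρ , τ) ∈ Q → ⟦ π ⟧ z → ⟦ ρ ⟧ z → (π , σ) ≡ (ρ , τ)) →
          (∀ {π σ} → (π , σ) ∈ Q → 2 ^ (length π + (c + 2)) ≤ length σ) →
          ∀ D → (∀ {π σ} → (π , σ) ∈ Q → length π ≤ D × size (length σ) 1 ≤ D) →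
          2 ^ c * sum (map (λ q → hits D (proj₂ q)) Q) ≤ 2 ^ D
∑-hits≤ c Q uniq prefixFree short D large =
  *-cancelˡ-≤ (2 ^ D) {{m^n≢0 2 D}} (begin
    2 ^ D * (2 ^ c * sum (map h Q))
      ≡⟨ trans (sym (*-assoc (2 ^ D) (2 ^ c) _)) (sym (sum-*ˡ (2 ^ D * 2 ^ c) h Q)) ⟩
    sum (map (λ q → 2 ^ D * 2 ^ c * h q) Q)      ≤⟨ sum-mono _ _ Q each ⟩
    sum (map (λ q → 2 ^ D * weight q) Q)         ≡⟨ sum-*ˡ (2 ^ D) weight Q ⟩
    2 ^ D * sum (map weight Q)
      ≡⟨ cong (2 ^ D *_) (sym (∑-sum D (λ q z → bit (proj₁ q ⊑ᵇ z)) Q)) ⟩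
    2 ^ D * ∑ D (λ z → sum (map (λ q → bit (proj₁ q ⊑ᵇ z)) Q))
      -- At most one pair in `Q` has its program as a prefix of `z`, so the integrand is at most 1.
      ≤⟨ *-monoʳ-≤ (2 ^ D) (∑-mono D (λ z → sum-bit≤1 (λ q → proj₁ q ⊑ᵇ z) uniq (disjoint z))) ⟩
    2 ^ D * ∑ D (λ _ → 1)
      ≡⟨ cong (2 ^ D *_) (trans (∑-const D 1) (*-identityʳ _)) ⟩
    2 ^ D * 2 ^ D                                ∎)
  where
  open ≤-Reasoning
  h weight : String × String → ℕ
  h q      = hits D (proj₂ q)
  weight q = ∑ D (λ z → bit (proj₁ q ⊑ᵇ z))
  disjoint : ∀ z {p q} → p ∈ Q → q ∈ Q → (proj₁ p ⊑ᵇ z) ≡ true → (proj₁ q ⊑ᵇ z) ≡ true → p ≡ q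
  disjoint z p∈ q∈ p⊑z q⊑z = prefixFree z p∈ q∈ (⊑ᵇ⇒⟦⟧ _ z p⊑z) (⊑ᵇ⇒⟦⟧ _ z q⊑z)
  rearrange₁ : ∀ l w c h → l * w * c * h ≡ w * (l * c * h)
  rearrange₁ = solve-∀
  rearrange₂ : ∀ l c h → 4 * (l * c * h) ≡ l * (c * 4) * h
  rearrange₂ = solve-∀
  each : ∀ {q} → q ∈ Q → 2 ^ D * 2 ^ c * h q ≤ 2 ^ D * weight q
  each {π , σ} q∈ = begin
    2 ^ D * 2 ^ c * hσ
      ≡⟨ cong (λ k → k * 2 ^ c * hσ) (sym (∑-cylinder π (proj₁ (large q∈)))) ⟩
    2 ^ length π * wπ * 2 ^ c * hσ           ≡⟨ rearrange₁ (2 ^ length π) wπ (2 ^ c) hσ ⟩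
    wπ * (2 ^ length π * 2 ^ c * hσ)         ≤⟨ *-monoʳ-≤ wπ (*-cancelˡ-≤ 4 few) ⟩
    wπ * 2 ^ D                               ≡⟨ *-comm wπ (2 ^ D) ⟩
    2 ^ D * wπ                               ∎
    where
    hσ wπ : ℕ
    hσ = hits D σ
    wπ = weight (π , σ)
    few : 4 * (2 ^ length π * 2 ^ c * hσ) ≤ 4 * 2 ^ D
    few = begin
      4 * (2 ^ length π * 2 ^ c * hσ)        ≡⟨ rearrange₂ (2 ^ length π) (2 ^ c) hσ ⟩
      2 ^ length π * (2 ^ c * 2 ^ 2) * hσ
        ≡⟨ cong (λ k → 2 ^ length π * k * hσ) (sym (^-distribˡ-+-* 2 c 2)) ⟩
      2 ^ length π * 2 ^ (c + 2) * hσ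
        ≡⟨ cong (_* hσ) (sym (^-distribˡ-+-* 2 (length π) (c + 2))) ⟩
      2 ^ (length π + (c + 2)) * hσ          ≤⟨ *-monoˡ-≤ hσ (short q∈) ⟩
      length σ * hσ                          ≤⟨ *-monoˡ-≤ hσ (m≤n+m (length σ) 4) ⟩
      (4 + length σ) * hσ                    ≤⟨ proj₂ (hits-bounds σ (proj₂ (large q∈))) ⟩
      4 * 2 ^ D                              ∎

-- Partial recursive functions

mutual
  -- Since `Eval` is a relation, this is what identifies the value in a given evaluation of a code
  -- with the one known from `correct`.
  Eval-functional : ∀ {n} (e : Rec n) v {y y′} → Eval e v y → Eval e v y′ → y ≡ y′
  Eval-functional zeroᵣ        v        p q = trans p (sym q)
  Eval-functional sucᵣ         (a ∷ []) p q = trans p (sym q)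
  Eval-functional (projᵣ i)    v        p q = trans p (sym q)
  Eval-functional (compᵣ e es) v (w , ps , p) (w′ , qs , q)
    with refl ← Evals-functional es v w w′ ps qs = Eval-functional e w p q
  Eval-functional (precᵣ e h)  (a ∷ v)  p q = EvalPrec-functional e h a v p q
  Eval-functional (muᵣ e) v {y} {y′} (p , below) (p′ , below′) with <-cmp y y′
  ... | tri≈ _ y≡y′ _ = y≡y′
  ... | tri< y<y′ _ _ with k , q ← below′ y y<y′ with () ← Eval-functional e (y ∷ v) p q
  ... | tri> _ _ y′<y with k , q ← below y′ y′<y with () ← Eval-functional e (y′ ∷ v) p′ q

  Evals-functional : ∀ {m n} (es : Vec (Rec n) m) v w w′ →
                     Evals es v w → Evals es v w′ → w ≡ w′
  Evals-functional []       v []      []        _        _        = refl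
  Evals-functional (e ∷ es) v (y ∷ w) (y′ ∷ w′) (p , ps) (q , qs) =
    cong₂ _∷_ (Eval-functional e v p q) (Evals-functional es v w w′ ps qs)

  EvalPrec-functional : ∀ {n} (e : Rec n) h a v {y y′} →
                        EvalPrec e h a v y → EvalPrec e h a v y′ → y ≡ y′
  EvalPrec-functional e h zero    v p q = Eval-functional e v p q
  EvalPrec-functional e h (suc a) v (u , p , r) (u′ , q , s)
    with refl ← EvalPrec-functional e h a v p q = Eval-functional h (a ∷ u ∷ v) r s

-- Pairs a code with the total function it computes, so that programs are assembled by combinators
-- and reasoned about as functions; the partial machine is composed in by hand in `enumᵣ`.
record Recursive n (f : Vec ℕ n → ℕ) : Set where
  constructor recursive
  field
    code    : Rec n
    correct : ∀ v → Eval code v (f v)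
open Recursive

var : ∀ {n} (i : Fin n) → Recursive n (λ v → lookup v i)
var i = recursive (projᵣ i) (λ v → refl)

infixl 9 _⟨_⟩ _⟨_⨾_⟩ _⟨_⨾_⨾_⟩

_⟨_⟩ : ∀ {n f g} → Recursive 1 g → Recursive n f → Recursive n (λ v → g (f v ∷ []))
rg ⟨ rf ⟩ = recursive (compᵣ (code rg) (code rf ∷ []))
                      (λ v → _ , (correct rf v , tt) , correct rg _)

_⟨_⨾_⟩ : ∀ {n f₁ f₂ g} → Recursive 2 g → Recursive n f₁ → Recursive n f₂ →
         Recursive n (λ v → g (f₁ v ∷ f₂ v ∷ []))
rg ⟨ r₁ ⨾ r₂ ⟩ = recursive (compᵣ (code rg) (code r₁ ∷ code r₂ ∷ []))
                           (λ v → _ , (correct r₁ v , correct r₂ v , tt) , correct rg _)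

_⟨_⨾_⨾_⟩ : ∀ {n f₁ f₂ f₃ g} → Recursive 3 g →
           Recursive n f₁ → Recursive n f₂ → Recursive n f₃ →
           Recursive n (λ v → g (f₁ v ∷ f₂ v ∷ f₃ v ∷ []))
rg ⟨ r₁ ⨾ r₂ ⨾ r₃ ⟩ =
  recursive (compᵣ (code rg) (code r₁ ∷ code r₂ ∷ code r₃ ∷ []))
            (λ v → _ , (correct r₁ v , correct r₂ v , correct r₃ v , tt) , correct rg _)

suc-rec : Recursive 1 (λ v → suc (lookup v 0F))
suc-rec = recursive sucᵣ (λ { (a ∷ []) → refl })

constant : ∀ {n} k → Recursive n (λ _ → k)
constant zero    = recursive (compᵣ zeroᵣ []) (λ v → [] , tt , refl)
constant (suc k) = suc-rec ⟨ constant k ⟩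

recursion : ∀ {n b s} {f : Vec ℕ (suc n) → ℕ} → Recursive n b → Recursive (2 + n) s →
            (∀ v → f (0 ∷ v) ≡ b v) → (∀ a v → f (suc a ∷ v) ≡ s (a ∷ f (a ∷ v) ∷ v)) →
            Recursive (suc n) f
recursion {f = f} rb rs f0 fs =
  recursive (precᵣ (code rb) (code rs)) (λ { (a ∷ v) → go a v })
  where
  go : ∀ a v → EvalPrec (code rb) (code rs) a v (f (a ∷ v))
  go zero    v = subst (Eval (code rb) v) (sym (f0 v)) (correct rb v)
  go (suc a) v = f (a ∷ v) , go a v ,
    subst (Eval (code rs) (a ∷ f (a ∷ v) ∷ v)) (sym (fs a v)) (correct rs _)

abstract
  least-zero : ∀ (e : ℕ → ℕ) y → e y ≡ 0 → ∃[ m ] (e m ≡ 0 × (∀ {i} → e i ≡ 0 → m ≤ i))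
  least-zero e zero    ey = 0 , ey , λ _ → z≤n
  least-zero e (suc y) ey with e 0 in e0
  ... | zero  = 0 , e0 , λ _ → z≤n
  ... | suc _ with m , em , min ← least-zero (e ∘ suc) y ey = suc m , em , min′
    where
    min′ : ∀ {i} → e i ≡ 0 → suc m ≤ i
    min′ {zero}  ei with () ← trans (sym e0) ei
    min′ {suc i} ei = s≤s (min ei)

module Minimization {n} {e : Vec ℕ (suc n) → ℕ} (re : Recursive (suc n) e)
                    (total : ∀ v → ∃[ y ] e (y ∷ v) ≡ 0) where

  private
    found : ∀ v → ∃[ m ] (e (m ∷ v) ≡ 0 × (∀ {i} → e (i ∷ v) ≡ 0 → m ≤ i))
    found v = least-zero (λ y → e (y ∷ v)) (proj₁ (total v)) (proj₂ (total v))

  μ : Vec ℕ n → ℕ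
  μ v = proj₁ (found v)

  μ-zero : ∀ v → e (μ v ∷ v) ≡ 0
  μ-zero v = proj₁ (proj₂ (found v))

  μ-least : ∀ v {i} → e (i ∷ v) ≡ 0 → μ v ≤ i
  μ-least v = proj₂ (proj₂ (found v))

  μ-rec : Recursive n μ
  μ-rec = recursive (muᵣ (code re)) λ v →
      subst (Eval (code re) (μ v ∷ v)) (μ-zero v) (correct re _) , below v
    where
    below : ∀ v i → i < μ v → ∃[ k ] Eval (code re) (i ∷ v) (suc k)
    below v i i<μ with e (i ∷ v) in ei | correct re (i ∷ v)
    ... | zero  | _ = contradiction (μ-least v ei) (<⇒≱ i<μ)
    ... | suc k | p = k , p

-- Arithmetic

+-rec : Recursive 2 (λ v → lookup v 0F + lookup v 1F)
+-rec = recursion (var 0F) (suc-rec ⟨ var 1F ⟩) (λ { (b ∷ []) → refl }) (λ { a (b ∷ []) → refl })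

*-rec : Recursive 2 (λ v → lookup v 0F * lookup v 1F)
*-rec = recursion (constant 0) (+-rec ⟨ var 2F ⨾ var 1F ⟩)
                  (λ { (b ∷ []) → refl }) (λ { a (b ∷ []) → refl })

pred-rec : Recursive 1 (λ v → pred (lookup v 0F))
pred-rec = recursion (constant 0) (var 0F) (λ { [] → refl }) (λ { a [] → refl })

∸-rec : Recursive 2 (λ v → lookup v 0F ∸ lookup v 1F)
∸-rec = flipped ⟨ var 1F ⨾ var 0F ⟩
  where
  flipped : Recursive 2 (λ v → lookup v 1F ∸ lookup v 0F)
  flipped = recursion (var 0F) (pred-rec ⟨ var 1F ⟩) (λ { (b ∷ []) → refl })
                      (λ { a (b ∷ []) → sym (pred[m∸n]≡m∸[1+n] b a) })

2^-rec : Recursive 1 (λ v → 2 ^ lookup v 0F)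
2^-rec = recursion (constant 1) (*-rec ⟨ constant 2 ⨾ var 1F ⟩)
                   (λ { [] → refl }) (λ { a [] → refl })

-- Decidable conditions are coded as numbers that vanish exactly when they hold, the form that `muᵣ`
-- tests: `distance` codes an equality, a sum a conjunction, and `sumBelow` a bounded universal
-- quantifier.
distance : ℕ → ℕ → ℕ
distance a b = (a ∸ b) + (b ∸ a)

distance-rec : Recursive 2 (λ v → distance (lookup v 0F) (lookup v 1F))
distance-rec = +-rec ⟨ ∸-rec ⟨ var 0F ⨾ var 1F ⟩ ⨾ ∸-rec ⟨ var 1F ⨾ var 0F ⟩ ⟩

distance-self : ∀ a → distance a a ≡ 0
distance-self a rewrite n∸n≡0 a = refl

distance≡0⇒≡ : ∀ {a b} → distance a b ≡ 0 → a ≡ b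
distance≡0⇒≡ {a} {b} d≡0 =
  ≤-antisym (m∸n≡0⇒m≤n (m+n≡0⇒m≡0 (a ∸ b) d≡0)) (m∸n≡0⇒m≤n (m+n≡0⇒n≡0 (a ∸ b) d≡0))

odd : ℕ → Bool
odd zero    = false
odd (suc n) = not (odd n)

parity : ℕ → ℕ
parity n = bit (odd n)

bit-not : ∀ b → bit (not b) ≡ 1 ∸ bit b
bit-not true  = refl
bit-not false = refl

parity-rec : Recursive 1 (λ v → parity (lookup v 0F))
parity-rec = recursion (constant 0) (∸-rec ⟨ constant 1 ⨾ var 1F ⟩)
                       (λ { [] → refl }) (λ { a [] → bit-not (odd a) })

half : ℕ → ℕ
half zero    = 0
half (suc n) = half n + parity n

half-rec : Recursive 1 (λ v → half (lookup v 0F))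
half-rec = recursion (constant 0) (+-rec ⟨ var 1F ⨾ parity-rec ⟨ var 0F ⟩ ⟩)
                     (λ { [] → refl }) (λ { a [] → refl })

odd-double : ∀ n → odd (double n) ≡ false
odd-double zero    = refl
odd-double (suc n) rewrite odd-double n = refl

odd-double+bit : ∀ n b → odd (double n + bit b) ≡ b
odd-double+bit n false rewrite +-identityʳ (double n) = odd-double n
odd-double+bit n true  rewrite +-comm (double n) 1 | odd-double n = refl

half-double : ∀ n → half (double n) ≡ n
half-double zero    = refl
half-double (suc n)
  rewrite odd-double n | half-double n | +-identityʳ n = +-comm n 1

half-double+bit : ∀ n b → half (double n + bit b) ≡ n
half-double+bit n false rewrite +-identityʳ (double n) = half-double n
half-double+bit n true
  rewrite +-comm (double n) 1 | odd-double n | half-double n = +-identityʳ n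

double-half+parity : ∀ n → double (half n) + parity n ≡ n
double-half+parity zero    = refl
double-half+parity (suc n) with odd n | double-half+parity n
... | false | ih rewrite +-identityʳ (half n) | +-identityʳ (double (half n)) =
  trans (+-comm _ 1) (cong suc ih)
... | true  | ih rewrite +-comm (half n) 1 | +-identityʳ (double (half n)) =
  cong suc (trans (+-comm 1 _) ih)

half≤ : ∀ n → half n ≤ n
half≤ zero    = z≤n
half≤ (suc n) = ≤-trans (+-mono-≤ (half≤ n) (bit≤1 (odd n))) (≤-reflexive (+-comm n 1))

sumBelow : (ℕ → ℕ) → ℕ → ℕ
sumBelow h zero    = 0
sumBelow h (suc b) = sumBelow h b + h b

sumBelow-rec : ∀ {h} → Recursive 3 h →
               Recursive 3 (λ v → sumBelow (λ j → h (j ∷ lookup v 1F ∷ lookup v 2F ∷ [])) (lookup v 0F))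
sumBelow-rec rh = recursion (constant 0) (+-rec ⟨ var 1F ⨾ rh ⟨ var 0F ⨾ var 2F ⨾ var 3F ⟩ ⟩)
                            (λ { (t ∷ s ∷ []) → refl }) (λ { a (t ∷ s ∷ []) → refl })

sumBelow≡0 : ∀ h b → (∀ {j} → j < b → h j ≡ 0) → sumBelow h b ≡ 0
sumBelow≡0 h zero    h≡0 = refl
sumBelow≡0 h (suc b) h≡0
  rewrite sumBelow≡0 h b (h≡0 ∘ m<n⇒m<1+n) = h≡0 (n<1+n b)

sumBelow≡0⁻¹ : ∀ h b → sumBelow h b ≡ 0 → ∀ {j} → j < b → h j ≡ 0
sumBelow≡0⁻¹ h (suc b) Σ≡0 {j} j<1+b with <-cmp j b
... | tri< j<b _ _  = sumBelow≡0⁻¹ h b (m+n≡0⇒m≡0 _ Σ≡0) j<b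
... | tri≈ _ refl _ = m+n≡0⇒n≡0 (sumBelow h b) Σ≡0
... | tri> _ _ b<j  = contradiction b<j (<⇒≱ j<1+b)

-- A surjection k ↦ (left k , right k) onto pairs: (a , b) is the value at
-- k = (a + b)² + a, where a + b = ⌊√k⌋ since a ≤ 2(a + b).
sqrt-total : (v : Vec ℕ 1) → ∃[ r ] suc (lookup v 0F) ∸ suc r * suc r ≡ 0
sqrt-total (k ∷ []) = k , m≤n⇒m∸n≡0 (m≤m*n (suc k) (suc k))

module Sqrt = Minimization
  {n = 1} {e = λ v → suc (lookup v 1F) ∸ suc (lookup v 0F) * suc (lookup v 0F)}
  (∸-rec ⟨ suc-rec ⟨ var 1F ⟩ ⨾ *-rec ⟨ suc-rec ⟨ var 0F ⟩ ⨾ suc-rec ⟨ var 0F ⟩ ⟩ ⟩)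
  sqrt-total

sqrt left right : ℕ → ℕ
sqrt k  = Sqrt.μ (k ∷ [])
left k  = k ∸ sqrt k * sqrt k
right k = sqrt k ∸ left k

sqrt-rec : Recursive 1 (λ v → sqrt (lookup v 0F))
sqrt-rec = Sqrt.μ-rec ⟨ var 0F ⟩

left-rec : Recursive 1 (λ v → left (lookup v 0F))
left-rec = ∸-rec ⟨ var 0F ⨾ *-rec ⟨ sqrt-rec ⨾ sqrt-rec ⟩ ⟩

right-rec : Recursive 1 (λ v → right (lookup v 0F))
right-rec = ∸-rec ⟨ sqrt-rec ⨾ left-rec ⟩

pair-surjective : ∀ a b → ∃[ k ] (left k ≡ a × right k ≡ b)
pair-surjective a b =
  k , left≡ , trans (cong (_∸ left k) sqrt≡) (trans (cong (s ∸_) left≡) (m+n∸m≡n a b))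
  where
  s k : ℕ
  s = a + b
  k = s * s + a
  k<[1+s]² : suc k ≤ suc s * suc s
  k<[1+s]² = s≤s (≤-trans (+-monoʳ-≤ (s * s) (m≤m+n a (b + s)))
                          (≤-reflexive (shape a b)))
    where
    shape : ∀ a b → (a + b) * (a + b) + (a + (b + (a + b))) ≡ a + b + (a + b) * suc (a + b)
    shape = solve-∀
  sqrt≡ : sqrt k ≡ s
  sqrt≡ = ≤-antisym (Sqrt.μ-least (k ∷ []) (m≤n⇒m∸n≡0 k<[1+s]²)) (≮⇒≥ smaller)
    where
    smaller : sqrt k < s → _
    smaller r<s = <⇒≱ (s≤s (≤-trans (*-mono-≤ r<s r<s) (m≤m+n (s * s) a)))
                      (m∸n≡0⇒m≤n (Sqrt.μ-zero (k ∷ [])))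
  left≡ : left k ≡ a
  left≡ = trans (cong (λ r → k ∸ r * r) sqrt≡) (m+n∸m≡n (s * s) a)

-- Strings as numbers

index-suc : ∀ z n → index (z ↾ suc n) ≡ suc (double (index (z ↾ n)) + bit (z n))
index-suc z n =
  trans (cong index (sym (applyUpTo-∷ʳ z n)))
        (trans (foldl-∷ʳ child 0 (z n) (z ↾ n)) (child-double (index (z ↾ n)) (z n)))

-- On indices, deletion of the last bit. The root 0 is its own parent, so `ancestor` is total, and
-- `len` is the least number of deletions that reaches 0.
parent : ℕ → ℕ
parent a = half (pred a)

parent-index : ∀ z n → parent (index (z ↾ suc n)) ≡ index (z ↾ n)
parent-index z n rewrite index-suc z n = half-double+bit (index (z ↾ n)) (z n)

odd-index : ∀ z n → odd (index (z ↾ suc n)) ≡ not (z n)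
odd-index z n rewrite index-suc z n | odd-double+bit (index (z ↾ n)) (z n) = refl

ancestor : ℕ → ℕ → ℕ
ancestor zero    a = a
ancestor (suc j) a = parent (ancestor j a)

ancestor-rec : Recursive 2 (λ v → ancestor (lookup v 0F) (lookup v 1F))
ancestor-rec = recursion (var 0F) (half-rec ⟨ pred-rec ⟨ var 1F ⟩ ⟩)
                         (λ { (a ∷ []) → refl }) (λ { j (a ∷ []) → refl })

ancestor-index : ∀ z j n → ancestor j (index (z ↾ (j + n))) ≡ index (z ↾ n)
ancestor-index z zero    n = refl
ancestor-index z (suc j) n =
  trans (cong (λ k → parent (ancestor j (index (z ↾ k)))) (sym (+-suc j n)))
        (trans (cong parent (ancestor-index z j (suc n))) (parent-index z n))

ancestor-index-∸ : ∀ z {m n} → m ≤ n → ancestor (n ∸ m) (index (z ↾ n)) ≡ index (z ↾ m)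
ancestor-index-∸ z {m} {n} m≤n =
  trans (cong (λ k → ancestor (n ∸ m) (index (z ↾ k))) (sym (m∸n+n≡m m≤n)))
        (ancestor-index z (n ∸ m) m)

-- Every string becomes a prefix `z ↾ n`, where deleting the last bit just lowers `n`; facts proved
-- for such prefixes then pass to strings.
zeroExtend : String → Cantor
zeroExtend []      = const false
zeroExtend (b ∷ σ) = b ◂ zeroExtend σ

zeroExtend-↾ : ∀ σ → zeroExtend σ ↾ length σ ≡ σ
zeroExtend-↾ []      = refl
zeroExtend-↾ (b ∷ σ) = cong (b ∷_) (zeroExtend-↾ σ)

abstract
  index-surjective : ∀ a → ∃[ σ ] index σ ≡ a
  index-surjective = <-rec _ go
    where
    go : ∀ a → (∀ {b} → b < a → ∃[ σ ] index σ ≡ b) → ∃[ σ ] index σ ≡ a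
    go zero    ih = [] , refl
    go (suc a) ih with σ , σ≡ ← ih (s≤s (half≤ a)) = σ ∷ʳ odd a , (begin
      index (σ ∷ʳ odd a)                ≡⟨ foldl-∷ʳ child 0 (odd a) σ ⟩
      child (index σ) (odd a)           ≡⟨ child-double (index σ) (odd a) ⟩
      suc (double (index σ) + parity a) ≡⟨ cong (λ i → suc (double i + parity a)) σ≡ ⟩
      suc (double (half a) + parity a)  ≡⟨ cong suc (double-half+parity a) ⟩
      suc a                             ∎)
      where open ≡-Reasoning

  ancestor-total : (v : Vec ℕ 1) → ∃[ j ] ancestor j (lookup v 0F) ≡ 0
  ancestor-total (a ∷ []) with σ , refl ← index-surjective a =
    length σ , subst (λ τ → ancestor (length σ) (index τ) ≡ 0) (zeroExtend-↾ σ)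
                 (ancestor-index-∸ (zeroExtend σ) {0} {length σ} z≤n)

module Len = Minimization
  {n = 1} {e = λ v → ancestor (lookup v 0F) (lookup v 1F)}
  (ancestor-rec ⟨ var 0F ⨾ var 1F ⟩) ancestor-total

len : ℕ → ℕ
len a = Len.μ (a ∷ [])

len-rec : Recursive 1 (λ v → len (lookup v 0F))
len-rec = Len.μ-rec ⟨ var 0F ⟩

len-index-↾ : ∀ z n → len (index (z ↾ n)) ≡ n
len-index-↾ z n = ≤-antisym (Len.μ-least (a ∷ []) root) (≮⇒≥ above)
  where
  a : ℕ
  a = index (z ↾ n)
  root : ancestor n a ≡ 0
  root = ancestor-index-∸ z {0} {n} z≤n
  above : len a < n → _
  above l<n = 0≢1+n (begin
    0                                       ≡⟨ sym (Len.μ-zero (a ∷ [])) ⟩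
    ancestor (len a) a
      ≡⟨ cong (λ j → ancestor j a) (sym (m∸[m∸n]≡n (<⇒≤ l<n))) ⟩
    ancestor (n ∸ (n ∸ len a)) a            ≡⟨ ancestor-index-∸ z (m∸n≤m n (len a)) ⟩
    index (z ↾ (n ∸ len a))
      ≡⟨ cong (λ k → index (z ↾ k)) (sym (suc-pred (n ∸ len a) {{>-nonZero (m<n⇒0<n∸m l<n)}})) ⟩
    index (z ↾ suc (pred (n ∸ len a)))      ≡⟨ index-suc z (pred (n ∸ len a)) ⟩
    suc _                                   ∎)
    where open ≡-Reasoning

index-↾-injective : ∀ y z n → index (y ↾ n) ≡ index (z ↾ n) → y ↾ n ≡ z ↾ n
index-↾-injective y z zero    eq = refl
index-↾-injective y z (suc n) eq = begin
  y ↾ suc n      ≡⟨ sym (applyUpTo-∷ʳ y n) ⟩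
  y ↾ n ∷ʳ y n   ≡⟨ cong₂ _∷ʳ_ (index-↾-injective y z n init) last ⟩
  z ↾ n ∷ʳ z n   ≡⟨ applyUpTo-∷ʳ z n ⟩
  z ↾ suc n      ∎
  where
  open ≡-Reasoning
  init : index (y ↾ n) ≡ index (z ↾ n)
  init = trans (sym (parent-index y n)) (trans (cong parent eq) (parent-index z n))
  last : y n ≡ z n
  last = Bool.not-injective (trans (sym (odd-index y n)) (trans (cong odd eq) (odd-index z n)))

len-index : ∀ σ → len (index σ) ≡ length σ
len-index σ =
  trans (cong (len ∘ index) (sym (zeroExtend-↾ σ))) (len-index-↾ (zeroExtend σ) (length σ))

index-injective : ∀ {σ τ} → index σ ≡ index τ → σ ≡ τ
index-injective {σ} {τ} eq = begin
  σ                            ≡⟨ sym (zeroExtend-↾ σ) ⟩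
  zeroExtend σ ↾ length σ      ≡⟨ index-↾-injective _ _ (length σ) same ⟩
  zeroExtend τ ↾ length σ      ≡⟨ cong (zeroExtend τ ↾_) length≡ ⟩
  zeroExtend τ ↾ length τ      ≡⟨ zeroExtend-↾ τ ⟩
  τ                            ∎
  where
  open ≡-Reasoning
  length≡ : length σ ≡ length τ
  length≡ = trans (sym (len-index σ)) (trans (cong len eq) (len-index τ))
  same : index (zeroExtend σ ↾ length σ) ≡ index (zeroExtend τ ↾ length σ)
  same = trans (cong index (zeroExtend-↾ σ)) (trans eq (trans (cong index (sym (zeroExtend-↾ τ)))
           (cong (λ n → index (zeroExtend τ ↾ n)) (sym length≡))))

-- A recursive check for hits and the enumeration of the levels

-- With t = index (z ↾ m), m = index (y ↾ n) and s = index (x ↾ n), the j-th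
-- ancestors of the node m and of s are y ↾ (n − j) and x ↾ (n − j), and the
-- bit of z labelling the node y ↾ (n − j) is the last one of the prefix of
-- z ↾ m whose length is the index of that node.
mismatch : ℕ → ℕ → ℕ → ℕ
mismatch j t s = distance (parity (ancestor (len t ∸ ancestor j (len t)) t))
                          (parity (ancestor j s))

mismatch-rec : Recursive 3 (λ v → mismatch (lookup v 0F) (lookup v 1F) (lookup v 2F))
mismatch-rec =
  distance-rec
    ⟨ parity-rec ⟨ ancestor-rec ⟨ ∸-rec ⟨ m ⨾ ancestor-rec ⟨ var 0F ⨾ m ⟩ ⟩ ⨾ var 1F ⟩ ⟩
    ⨾ parity-rec ⟨ ancestor-rec ⟨ var 0F ⨾ var 2F ⟩ ⟩ ⟩
  where
  m = len-rec ⟨ var 1F ⟩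

ancestor≤ : ∀ j a → ancestor j a ≤ a
ancestor≤ zero    a = ≤-refl
ancestor≤ (suc j) a = ≤-trans (half≤ _) (≤-trans pred[n]≤n (ancestor≤ j a))

↾-cong : ∀ (x y : Cantor) n → (∀ {i} → i < n → x i ≡ y i) → x ↾ n ≡ y ↾ n
↾-cong x y zero    h = refl
↾-cong x y (suc n) h = cong₂ _∷_ (h (s≤s z≤n)) (↾-cong (x ∘ suc) (y ∘ suc) n (h ∘ s≤s))

parity-injective : ∀ b c → bit (not b) ≡ bit (not c) → b ≡ c
parity-injective true  true  _ = refl
parity-injective false false _ = refl

n∸suc[n∸suc] : ∀ {i n} → i < n → n ∸ suc (n ∸ suc i) ≡ i
n∸suc[n∸suc] {i} {suc n} (s≤s i≤n) = m∸[m∸n]≡n i≤n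

module _ (z y x : Cantor) (n : ℕ) where
  private
    m t s : ℕ
    m = index (y ↾ n)
    t = index (z ↾ m)
    s = index (x ↾ n)

  -- The parity of the index of a nonempty string is the negation of its last bit; both sides are
  -- negated alike, so comparing parities compares bits.
  mismatch-at : ∀ {i} → i < n →
                mismatch (n ∸ suc i) t s ≡ distance (bit (not (F z y i))) (bit (not (x i)))
  mismatch-at {i} i<n =
    cong₂ distance label (trans (cong parity (ancestor-index-∸ x i<n)) (cong bit (odd-index x i)))
    where
    open ≡-Reasoning
    node = ancestor (n ∸ suc i) m
    node≡ : node ≡ index (y ↾ suc i)
    node≡ = ancestor-index-∸ y i<n
    -- The node is not the root, so the `pred` in `f` undoes a genuine successor.
    node≡suc : node ≡ suc (pred (index (y ↾ suc i)))
    node≡suc = trans node≡ (trans (index-suc y i) (cong (suc ∘ pred) (sym (index-suc y i))))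
    label : parity (ancestor (len t ∸ ancestor (n ∸ suc i) (len t)) t) ≡ bit (not (F z y i))
    label = begin
      parity (ancestor (len t ∸ ancestor (n ∸ suc i) (len t)) t)
        ≡⟨ cong (λ l → parity (ancestor (l ∸ ancestor (n ∸ suc i) l) t)) (len-index-↾ z m) ⟩
      parity (ancestor (m ∸ node) t)
        ≡⟨ cong parity (ancestor-index-∸ z (ancestor≤ (n ∸ suc i) m)) ⟩
      parity (index (z ↾ node))
        ≡⟨ cong (λ k → parity (index (z ↾ k))) node≡suc ⟩
      parity (index (z ↾ suc (pred (index (y ↾ suc i)))))
        ≡⟨ cong bit (odd-index z (pred (index (y ↾ suc i)))) ⟩
      bit (not (F z y i)) ∎

  mismatch≡0⇒F : (∀ {j} → j < n → mismatch j t s ≡ 0) → F z y ↾ n ≡ x ↾ n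
  mismatch≡0⇒F h = ↾-cong (F z y) x n λ {i} i<n →
    parity-injective _ _ (distance≡0⇒≡
      (trans (sym (mismatch-at i<n)) (h (∸-monoʳ-< {n} {suc i} {0} (s≤s z≤n) i<n))))

  F⇒mismatch≡0 : F z y ≗ x → ∀ {j} → j < n → mismatch j t s ≡ 0
  F⇒mismatch≡0 F≗x {j} j<n = begin
    mismatch j t s                  ≡⟨ cong (λ k → mismatch k t s) (sym (n∸suc[n∸suc] j<n)) ⟩
    mismatch (n ∸ suc i) t s        ≡⟨ mismatch-at (∸-monoʳ-< {n} {suc j} {0} (s≤s z≤n) j<n) ⟩
    distance (bit (not (F z y i))) (bit (not (x i)))
                                    ≡⟨ cong (λ b → distance (bit (not b)) (bit (not (x i)))) (F≗x i) ⟩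
    distance (bit (not (x i))) (bit (not (x i))) ≡⟨ distance-self (bit (not (x i))) ⟩
    0                               ∎
    where
    open ≡-Reasoning
    i : ℕ
    i = n ∸ suc j

-- Zero iff the program left k, with output s, is so short for s that s
-- belongs to level c of the test, and the codes extending right k have s in
-- their range as witnessed by the node len (right k).
defect : ℕ → ℕ → ℕ → ℕ
defect c k s =
  (2 ^ (len (left k) + (c + 2)) ∸ len s) +
  (distance (len (len (right k))) (len s) +
   sumBelow (λ j → mismatch j (right k) s) (len s))

defect-rec : Recursive 3 (λ v → defect (lookup v 0F) (lookup v 1F) (lookup v 2F))
defect-rec =
  +-rec
    ⟨ ∸-rec ⟨ 2^-rec ⟨ +-rec ⟨ len-rec ⟨ left-rec ⟨ k ⟩ ⟩ ⨾ +-rec ⟨ var 0F ⨾ constant 2 ⟩ ⟩ ⟩ ⨾ |s| ⟩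
    ⨾ +-rec ⟨ distance-rec ⟨ len-rec ⟨ len-rec ⟨ t ⟩ ⟩ ⨾ |s| ⟩
            ⨾ sumBelow-rec mismatch-rec ⟨ |s| ⨾ t ⨾ var 2F ⟩ ⟩ ⟩
  where
  k   = var 1F
  t   = right-rec ⟨ k ⟩
  |s| = len-rec ⟨ var 2F ⟩

-- The minimised function ignores the search variable, so `muᵣ` returns 0 at once if the defect is 0
-- and diverges otherwise: it is a guard on the domain. The outer projection discards this 0 and
-- returns `right k`.
checkᵣ : Rec 3
checkᵣ = compᵣ (projᵣ 1F)
  ( muᵣ (compᵣ (code defect-rec) (projᵣ 1F ∷ projᵣ 2F ∷ projᵣ 3F ∷ []))
  ∷ code (right-rec ⟨ var 1F ⟩)
  ∷ [])

-- Composition is strict: if the program coded by `left k` does not halt, `k` enumerates nothing. As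
-- levels are ranges of partial functions, divergence takes the place of dovetailing.
enumᵣ : Rec 1 → Rec 2
enumᵣ M = compᵣ checkᵣ
  (projᵣ 0F ∷ projᵣ 1F ∷ compᵣ M (code (left-rec ⟨ var 1F ⟩) ∷ []) ∷ [])

enum-complete : ∀ M {c k s} → Eval M (left k ∷ []) s → defect c k s ≡ 0 →
                Eval (enumᵣ M) (c ∷ k ∷ []) (right k)
enum-complete M {c} {k} {s} Ms defect≡0 =
    (c ∷ k ∷ s ∷ [])
  , (refl , refl , ((left k ∷ []) , (correct (left-rec ⟨ var 1F ⟩) _ , tt) , Ms) , tt)
  , (0 ∷ right k ∷ [])
  , ( ( ((c ∷ k ∷ s ∷ []) , (refl , refl , refl , tt)
        , subst (Eval (code defect-rec) (c ∷ k ∷ s ∷ [])) defect≡0 (correct defect-rec _))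
      , λ _ ())
    , correct (right-rec ⟨ var 1F ⟩) _
    , tt)
  , refl

enum-sound : ∀ M {c k t} → Eval (enumᵣ M) (c ∷ k ∷ []) t →
             t ≡ right k × ∃[ s ] (Eval M (left k ∷ []) s × defect c k s ≡ 0)
enum-sound M {c} {k}
  ( (_ ∷ _ ∷ s ∷ []) , (refl , refl , ((a ∷ []) , (leftk , tt) , Ms) , tt)
  , (_ ∷ r ∷ []) , ((((_ ∷ _ ∷ _ ∷ []) , (refl , refl , refl , tt) , defect≡0) , _) , rightk , tt)
  , refl) =
    Eval-functional (code (right-rec ⟨ var {3} 1F ⟩)) (c ∷ k ∷ s ∷ [])
      rightk (correct (right-rec ⟨ var 1F ⟩) _)
  , s
  , subst (λ a → Eval M (a ∷ []) s)
      (Eval-functional (code (left-rec ⟨ var {2} 1F ⟩)) (c ∷ k ∷ [])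
        leftk (correct (left-rec ⟨ var 1F ⟩) _)) Ms
  , Eval-functional (code defect-rec) (c ∷ k ∷ s ∷ []) (correct defect-rec _) defect≡0

-- One witness `y` serves every `z` in the cylinder of `τ`: an extension of the node with index
-- `length τ`, since `τ` fixes all labels on the path to that node.
enumerates-sound : ∀ M {c τ} → Enumerates (enumᵣ M) c τ →
  ∃[ π ] ∃[ σ ] (Outputs M π σ × 2 ^ (length π + (c + 2)) ≤ length σ ×
                 (∀ z → ⟦ τ ⟧ z → hitᵇ z 0 σ ≡ true))
enumerates-sound M {c} {τ} (k , e)
  with t≡ , s , Ms , defect≡0 ← enum-sound M e
  with π , π≡ ← index-surjective (left k) | σ , refl ← index-surjective s
     | μ , μ≡ ← index-surjective (length τ)
  = π , σ , subst (λ a → Eval M (a ∷ []) (index σ)) (sym π≡) Ms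
  , subst₂ (λ p n → 2 ^ (p + (c + 2)) ≤ n) (trans (cong len (sym π≡)) (len-index π)) (len-index σ)
      (m∸n≡0⇒m≤n (m+n≡0⇒m≡0 _ defect≡0))
  , hit
  where
  n : ℕ
  n = length σ
  rest≡0 : distance (len (len (right k))) (len (index σ)) +
           sumBelow (λ j → mismatch j (right k) (index σ)) (len (index σ)) ≡ 0
  rest≡0 = m+n≡0⇒n≡0 (2 ^ (len (left k) + (c + 2)) ∸ len (index σ)) defect≡0
  y x : Cantor
  y = zeroExtend μ
  x = zeroExtend σ
  |μ|≡n : length μ ≡ n
  |μ|≡n = begin
    length μ               ≡⟨ sym (len-index μ) ⟩
    len (index μ)          ≡⟨ cong len μ≡ ⟩
    len (length τ)         ≡⟨ cong len (sym (len-index τ)) ⟩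
    len (len (index τ))    ≡⟨ cong (len ∘ len) t≡ ⟩
    len (len (right k))    ≡⟨ distance≡0⇒≡ (m+n≡0⇒m≡0 _ rest≡0) ⟩
    len (index σ)          ≡⟨ len-index σ ⟩
    n                      ∎
    where open ≡-Reasoning
  node : index (y ↾ n) ≡ length τ
  node = trans (cong (λ l → index (y ↾ l)) (sym |μ|≡n)) (trans (cong index (zeroExtend-↾ μ)) μ≡)
  hit : ∀ z → ⟦ τ ⟧ z → hitᵇ z 0 σ ≡ true
  hit z z∈τ = F⇒hitᵇ z σ y (trans (mismatch≡0⇒F z y x n agreement) (zeroExtend-↾ σ))
    where
    t≡′ : index (z ↾ index (y ↾ n)) ≡ right k
    t≡′ = trans (cong (λ l → index (z ↾ l)) node) (trans (cong index z∈τ) t≡)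
    agreement : ∀ {j} → j < n → mismatch j (index (z ↾ index (y ↾ n))) (index (x ↾ n)) ≡ 0
    agreement {j} j<n =
      trans (cong₂ (mismatch j) t≡′ (cong index (zeroExtend-↾ σ)))
            (sumBelow≡0⁻¹ _ (len (index σ))
              (m+n≡0⇒n≡0 (distance (len (len (right k))) (len (index σ))) rest≡0)
              (subst (j <_) (sym (len-index σ)) j<n))

enumerates-complete : ∀ M {c π n z y x} → F z y ≗ x → Outputs M π (x ↾ n) →
  2 ^ (length π + (c + 2)) ≤ n →
  ∃[ τ ] (Enumerates (enumᵣ M) c τ × ⟦ τ ⟧ z)
enumerates-complete M {c} {π} {n} {z} {y} {x} F≗x Mπ short
  with k , left≡ , right≡ ← pair-surjective (index π) (index (z ↾ index (y ↾ n)))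
  = z ↾ m , (k , subst (Eval (enumᵣ M) (c ∷ k ∷ [])) right≡
                   (enum-complete M (subst (λ a → Eval M (a ∷ []) s) (sym left≡) Mπ) defect≡0))
  , cong (z ↾_) (length-applyUpTo z m)
  where
  m s : ℕ
  m = index (y ↾ n)
  s = index (x ↾ n)
  len-s : len s ≡ n
  len-s = len-index-↾ x n
  short≡0 : 2 ^ (len (left k) + (c + 2)) ∸ len s ≡ 0
  short≡0 = m≤n⇒m∸n≡0 (subst₂ (λ p l → 2 ^ (p + (c + 2)) ≤ l)
              (trans (sym (len-index π)) (cong len (sym left≡))) (sym len-s) short)
  len-node : len (len (right k)) ≡ n
  len-node = trans (cong (len ∘ len) right≡) (trans (cong len (len-index-↾ z m)) (len-index-↾ y n))
  agreement : ∀ {j} → j < len s → mismatch j (right k) s ≡ 0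
  agreement {j} j< = trans (cong (λ t → mismatch j t s) right≡)
                           (F⇒mismatch≡0 z y x n F≗x (subst (j <_) len-s j<))
  defect≡0 : defect c k s ≡ 0
  defect≡0 = cong₂ _+_ short≡0
    (cong₂ _+_ (trans (cong₂ distance len-node len-s) (distance-self n))
               (sumBelow≡0 _ (len s) agreement))

-- Fractions

toℚᵘ-/ : ∀ a d-1 → toℚᵘ (ℤ.+ a ℚ./ suc d-1) ℚᵘ.≃ mkℚᵘ (ℤ.+ a) d-1
toℚᵘ-/ a d-1 = ℚ.toℚᵘ-fromℚᵘ (mkℚᵘ (ℤ.+ a) d-1)

/-mono-≤ : ∀ a d b e .{{_ : NonZero d}} .{{_ : NonZero e}} →
           a * e ≤ b * d → ℤ.+ a ℚ./ d ℚ.≤ ℤ.+ b ℚ./ e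
/-mono-≤ a (suc d-1) b (suc e-1) ae≤bd = ℚ.toℚᵘ-cancel-≤
  (ℚᵘ.≤-respˡ-≃ (ℚᵘ.≃-sym (toℚᵘ-/ a d-1))
    (ℚᵘ.≤-respʳ-≃ (ℚᵘ.≃-sym (toℚᵘ-/ b e-1))
      (*≤* (subst₂ ℤ._≤_ (pos-* a (suc e-1)) (pos-* b (suc d-1)) (+≤+ ae≤bd)))))

1≤*/ : ∀ k a d .{{_ : NonZero d}} → d ≤ k * a → 1ℚ ℚ.≤ (ℤ.+ k ℚ./ 1) ℚ.* (ℤ.+ a ℚ./ d)
1≤*/ k a (suc d-1) d≤ka = ℚ.toℚᵘ-cancel-≤
  (ℚᵘ.≤-respʳ-≃ (ℚᵘ.≃-sym (ℚᵘ.≃-trans (ℚ.toℚᵘ-homo-* (ℤ.+ k ℚ./ 1) (ℤ.+ a ℚ./ suc d-1))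
                                    (ℚᵘ.*-cong (toℚᵘ-/ k 0) (toℚᵘ-/ a d-1))))
    (*≤* (subst₂ ℤ._≤_ (pos-* 1 (1 * suc d-1))
      (trans (pos-* (k * a) 1) (cong (ℤ._* ℤ.+ 1) (pos-* k a)))
      (+≤+ (subst₂ _≤_ (sym (trans (*-identityˡ _) (*-identityˡ _)))
        (sym (*-identityʳ (k * a))) d≤ka)))))

-- The test

_≟ₚ_ : DecidableEquality (String × String)
_≟ₚ_ = Product.≡-dec (≡-dec Bool._≟_) (≡-dec Bool._≟_)

module _ (M : Rec 1) (prefixFree : PrefixFree M) where

  Outputs-functional : ∀ {π σ τ} → Outputs M π σ → Outputs M π τ → σ ≡ τ
  Outputs-functional {π} p q = index-injective (Eval-functional M (index π ∷ []) p q)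

  -- Two prefixes of the same `z` are comparable, so prefix-freeness identifies the programs, and
  -- functionality of `Eval` their outputs.
  outputs-disjoint : ∀ z {π σ ρ τ} → Outputs M π σ → Outputs M ρ τ →
                     ⟦ π ⟧ z → ⟦ ρ ⟧ z → (π , σ) ≡ (ρ , τ)
  outputs-disjoint z {π} {σ} {ρ} {τ} Mπ Mρ π⊑z ρ⊑z with same (≤-total (length π) (length ρ))
    where
    same : _ → π ≡ ρ
    same (inj₁ π≤ρ) = prefixFree {π} {ρ} {σ} {τ} Mπ Mρ
      (subst₂ (Prefix _≡_) π⊑z ρ⊑z (↾-prefix z π≤ρ))
    same (inj₂ ρ≤π) = sym (prefixFree {ρ} {π} {τ} {σ} Mρ Mπ
      (subst₂ (Prefix _≡_) ρ⊑z π⊑z (↾-prefix z ρ≤π)))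
  ... | refl = cong (π ,_) (Outputs-functional {π} Mπ Mρ)

  record Short (c : ℕ) (q : String × String) : Set where
    constructor short
    field
      outputs : Outputs M (proj₁ q) (proj₂ q)
      bound   : 2 ^ (length (proj₁ q) + (c + 2)) ≤ length (proj₂ q)
  open Short

  programs : ∀ {c} L → All (Enumerates (enumᵣ M) c) L →
             ∃[ Q ] (All (Short c) Q ×
                     (∀ z → Any (λ τ → ⟦ τ ⟧ z) L → ∃[ q ] (q ∈ Q × hitᵇ z 0 (proj₂ q) ≡ true)))
  programs []      []       = [] , [] , λ _ ()
  programs (τ ∷ L) (e ∷ es)
    with Q , shorts , covers ← programs L es
       | π , σ , Mπ , bnd , hit ← enumerates-sound M e
    = (π , σ) ∷ Q , short Mπ bnd ∷ shorts , covers′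
    where
    covers′ : ∀ z → Any (λ τ → ⟦ τ ⟧ z) (τ ∷ L) →
              ∃[ q ] (q ∈ (π , σ) ∷ Q × hitᵇ z 0 (proj₂ q) ≡ true)
    covers′ z (here z∈τ) = (π , σ) , here refl , hit z z∈τ
    covers′ z (there z∈) with q , q∈ , hq ← covers z z∈ = q , there q∈ , hq

  -- A finite union bound: a finite `L` involves finitely many program-output pairs, whose hitting
  -- events cover its cylinders.
  enum-small : ∀ c → OpenMeasure≤ (Enumerates (enumᵣ M) c) (ℚ._/_ (ℤ.+ 1) (2 ^ c) {{m^n≢0 2 c}})
  enum-small c L es r m with Q₀ , shorts , covers ← programs L es =
    subst (ℚ._≤ (ℚ._/_ (ℤ.+ 1) (2 ^ c) {{m^n≢0 2 c}})) (sym measure)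
      (/-mono-≤ (length strings) (2 ^ depth) 1 (2 ^ c) {{m^n≢0 2 depth}} {{m^n≢0 2 c}}
        (*-cancelʳ-≤ _ _ (2 ^ D) {{m^n≢0 2 D}} bounded))
    where
    open HasMeasure m
    open ≤-Reasoning
    Q : List (String × String)
    -- Several strings of `L` may stem from one program, but each pair must count once in Kraft's
    -- inequality.
    Q = deduplicate _≟ₚ_ Q₀
    Q-short : ∀ {q} → q ∈ Q → Short c q
    Q-short q∈ = All.lookup shorts (∈-deduplicate⁻ _≟ₚ_ Q₀ q∈)
    extent : String × String → ℕ
    extent (π , σ) = length π + size (length σ) 1
    D : ℕ
    -- Deep enough for the given clopen set, for the cylinders of all programs and for the labels
    -- that decide whether their outputs are hit.
    D = depth + sum (map extent Q)
    extent≤D : ∀ {q} → q ∈ Q → extent q ≤ D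
    extent≤D q∈ = ≤-trans (∈⇒≤sum extent q∈) (m≤n+m _ depth)
    hitCount : Cantor → ℕ
    hitCount z = sum (map (λ q → bit (hitᵇ z 0 (proj₂ q))) Q)
    hitCount≥1 : ∀ z → Any (λ τ → ⟦ τ ⟧ z) L → 1 ≤ hitCount z
    hitCount≥1 z z∈ with q , q∈ , hq ← covers z z∈ =
      ≤-trans (≤-reflexive (sym (cong bit hq)))
              (∈⇒≤sum (λ q → bit (hitᵇ z 0 (proj₂ q))) (∈-deduplicate⁺ _≟ₚ_ q∈))
    rearrange : ∀ s c d → s * c * d ≡ c * (s * d)
    rearrange = solve-∀
    rearrange′ : ∀ c d h → c * (d * h) ≡ d * (c * h)
    rearrange′ = solve-∀
    bounded : length strings * 2 ^ c * 2 ^ D ≤ 1 * 2 ^ depth * 2 ^ D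
    bounded = begin
      length strings * 2 ^ c * 2 ^ D       ≡⟨ rearrange (length strings) (2 ^ c) (2 ^ D) ⟩
      2 ^ c * (length strings * 2 ^ D)
        ≤⟨ *-monoʳ-≤ (2 ^ c) (measure≤∑ m hitCount (m≤m+n depth _) hitCount≥1) ⟩
      2 ^ c * (2 ^ depth * ∑ D hitCount)   ≡⟨ rearrange′ (2 ^ c) (2 ^ depth) (∑ D hitCount) ⟩
      2 ^ depth * (2 ^ c * ∑ D hitCount)
        ≡⟨ cong (λ k → 2 ^ depth * (2 ^ c * k)) (∑-sum D (λ q z → bit (hitᵇ z 0 (proj₂ q))) Q) ⟩
      2 ^ depth * (2 ^ c * sum (map (λ q → hits D (proj₂ q)) Q))
        ≤⟨ *-monoʳ-≤ (2 ^ depth) (∑-hits≤ c Q (Unique.deduplicate-! _≟ₚ_ Q₀)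
             (λ z p∈ q∈ → outputs-disjoint z (outputs (Q-short p∈)) (outputs (Q-short q∈)))
             (bound ∘ Q-short) D
             (λ q∈ → ≤-trans (m≤m+n _ _) (extent≤D q∈) , ≤-trans (m≤n+m _ _) (extent≤D q∈))) ⟩
      2 ^ depth * 2 ^ D                    ≡⟨ cong (_* 2 ^ D) (sym (*-identityˡ (2 ^ depth))) ⟩
      1 * 2 ^ depth * 2 ^ D                ∎

  hittingTest : MLTest
  hittingTest = record { enum = enumᵣ M ; small = enum-small }

-- Logarithmic lower bounds

n<2^n : ∀ n → n < 2 ^ n
n<2^n zero    = s≤s z≤n
n<2^n (suc n) = +-mono-≤ (m^n>0 2 n) (≤-trans (n<2^n n) (≤-reflexive (sym (+-identityʳ _))))

module LogBound (d : ℕ) where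

  log-total : (v : Vec ℕ 1) → ∃[ k ] lookup v 0F ∸ 2 ^ (k + d) ≡ 0
  log-total (n ∷ []) =
    n , m≤n⇒m∸n≡0 (≤-trans (<⇒≤ (n<2^n n)) (^-monoʳ-≤ 2 (m≤m+n n d)))

  module Log = Minimization
    {n = 1} {e = λ v → lookup v 1F ∸ 2 ^ (lookup v 0F + d)}
    (∸-rec ⟨ var 1F ⨾ 2^-rec ⟨ +-rec ⟨ var 0F ⨾ constant d ⟩ ⟩ ⟩)
    log-total

  -- For positive `n`, the maximum of 0 and the rounded-up binary logarithm of `n` minus `d`.
  -- Lowering by `d` absorbs the additive constant, so that the order lies below `K` itself.
  log : ℕ → ℕ
  log n = Log.μ (n ∷ [])

  log-spec : ∀ n → n ≤ 2 ^ (log n + d)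
  log-spec n = m∸n≡0⇒m≤n (Log.μ-zero (n ∷ []))

  log-least : ∀ n {k} → n ≤ 2 ^ (k + d) → log n ≤ k
  log-least n h = Log.μ-least (n ∷ []) (m≤n⇒m∸n≡0 h)

  log-computable : Computable log
  log-computable = code Log.μ-rec , λ n → correct Log.μ-rec (n ∷ [])

  log-order : IsOrder log
  log-order = record
    { monotone  = λ {m} {n} m≤n → log-least m (≤-trans m≤n (log-spec n))
    ; unbounded = λ b → suc (2 ^ (b + d)) , ≮⇒≥ λ log<b →
        <⇒≱ (log-spec (suc (2 ^ (b + d)))) (^-monoʳ-≤ 2 (+-monoˡ-≤ d (<⇒≤ log<b)))
    }

-- The bound on complexity

measure-lower : ∀ {q} σ k → HasMeasure (λ z → ∃[ y ] ⟦ σ ⟧ (F z y)) q →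
                length σ < k → 1ℚ ℚ.≤ (ℤ.+ k ℚ./ 1) ℚ.* q
measure-lower {q} σ k m n<k =
  subst (λ q → 1ℚ ℚ.≤ (ℤ.+ k ℚ./ 1) ℚ.* q) (sym measure)
    (1≤*/ k (length strings) (2 ^ depth) {{m^n≢0 2 depth}}
      (*-cancelʳ-≤ _ _ (2 ^ D) {{m^n≢0 2 D}} bounded))
  where
  open HasMeasure m
  open ≤-Reasoning
  D : ℕ
  D = depth + size (length σ) 1
  swap : ∀ a b c → a * (b * c) ≡ b * (a * c)
  swap = solve-∀
  bounded : 2 ^ depth * 2 ^ D ≤ k * length strings * 2 ^ D
  bounded = begin
    2 ^ depth * 2 ^ D
      ≤⟨ *-monoʳ-≤ (2 ^ depth) (proj₁ (hits-bounds σ (m≤n+m _ depth))) ⟩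
    2 ^ depth * (suc (length σ) * hits D σ)   ≤⟨ *-monoʳ-≤ (2 ^ depth) (*-monoˡ-≤ (hits D σ) n<k) ⟩
    2 ^ depth * (k * hits D σ)                ≡⟨ swap (2 ^ depth) k (hits D σ) ⟩
    k * (2 ^ depth * hits D σ)
      ≤⟨ *-monoʳ-≤ k (∑≤measure m (λ z → hitᵇ z 0 σ) (m≤m+n depth _) (λ z → hitᵇ⇒F z σ)) ⟩
    k * (length strings * 2 ^ D)              ≡⟨ sym (*-assoc k (length strings) (2 ^ D)) ⟩
    k * length strings * 2 ^ D                ∎

-- Randomness only says that not every level contains `z`, so the bound is obtained by
-- contradiction: its failure with constant `c + 2` puts `z` into level `c`.
complexity-bound : ExcludedMiddle 0ℓ → ∀ (K : String → ℕ) → IsPrefixComplexity K →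
                   ∀ {x} → InRangeOfRandomOnline x → ∃[ c ] (∀ n → n < 2 ^ (K (x ↾ n) + c))
complexity-bound em K isK {x} (z , random , y , F≗x)
  with em {∃[ c ] (∀ n → n < 2 ^ (K (x ↾ n) + c))}
... | yes bounded = bounded
... | no ¬bounded = contradiction caught (random test)
  where
  open IsPrefixComplexity isK
  test : MLTest
  test = hittingTest machine (λ {π ρ σ τ} → OptimalPrefixFree.prefixFree isOpt {π} {ρ} {σ} {τ})
  caught : ∀ c → z ∈Component c of test
  caught c with em {∃[ n ] (2 ^ (K (x ↾ n) + (c + 2)) ≤ n)}
  ... | no  none = contradiction (c + 2 , λ n → ≰⇒> λ h → none (n , h)) ¬bounded
  ... | yes (n , h) with π , Mπ , |π|≡K ← attained (x ↾ n) =
    enumerates-complete machine {c} {π} {n} {z} {y} {x} F≗x Mπ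
      (subst (λ l → 2 ^ (l + (c + 2)) ≤ n) (sym |π|≡K) h)

corollary5p7 : ExcludedMiddle 0ℓ →
    ∀ (K : String → ℕ) → IsPrefixComplexity K →
    ∀ (p : ℕ → ℚ) → HittingProbabilities p →
    ∀ (x : Cantor) → InRangeOfRandomOnline x →
    (∃[ c ] (∀ n → K (x ↾ n) ≥-log₂ p n - c)) × Complex K x
corollary5p7 em K isK p hitting x inRange
  with c , n<2^ ← complexity-bound em K isK inRange
  = (c , λ n → subst (λ l → K (x ↾ n) ≥-log₂ p l - c) (length-applyUpTo x n)
       -- Strictness of `n < 2 ^ (K (x ↾ n) + c)` absorbs the 1 in `1/(n+1) ≤ p n`.
       (measure-lower (x ↾ n) (2 ^ (K (x ↾ n) + c)) (hitting (x ↾ n))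
         (subst (_< 2 ^ (K (x ↾ n) + c)) (sym (length-applyUpTo x n)) (n<2^ n))))
  , (log c , log-computable c , log-order c , λ n → log-least c n (<⇒≤ (n<2^ n)))
  where open LogBound
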